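{- Let $G$ be a finite simple connected walk-regular graph, and let $u,v$ (with $u\ne v$) and $w,z$ (with $w\neq z$) be pairs of vertices of $G$ such that $u\sim v$ if and only if $w\sim z$. Then the following statements are equivalent: (a) $\operatorname{sp}(G\pm uv)=\operatorname{sp}(G\pm wz)$. (b) $\operatorname{sp} G_{u+v}=\operatorname{sp} G_{w+z}$. (c) $\operatorname{sp}(G+u\bar u v)=\operatorname{sp}(G+w\bar w z)$.
   Context: $u\sim v$ means that $u$ and $v$ are adjacent. $\operatorname{sp}$ denotes the spectrum (eigenvalues with multiplicities) of the adjacency matrix of a graph or pseudograph (a graph possibly with loops and multiple edges). A graph with adjacency matrix $A=(a_{xy})$ is walk-regular if for every $\ell\ge 0$ the number $(A^\ell)_{uu}$ does not depend on the vertex $u$. For distinct vertices $u,v$: - $G\pm uv$ is the graph obtained from $G$ by flipping $uv$: the edge $uv$ is deleted if $u\sim v$, and added if $u\not\sim v$. - $G_{u+v}$ is the pseudograph obtained from $G$ by amalgamating $u$ and $v$ into a single new vertex $u+v$: the adjacencies among the other vertices are unchanged, the entry of the adjacency matrix for $u+v$ and another vertex $x$ is $a_{ux}+a_{vx}$ (so common neighbors produce multiple edges), and the diagonal entry at $u+v$ is $a_{uv}$ (so if $u\sim v$ the edge $uv$ becomes a loop, contributing $1$). - $G+u\bar u v$ is the graph obtained from $G$ by adding a new vertex $\bar u$ adjacent exactly to $u$ and $v$. -}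

module Defs where

open import Level using (_⊔_)
open import Algebra.Bundles using (CommutativeRing; Semiring)
open import Algebra.Apartness.Bundles using (HeytingField; HeytingCommutativeRing)
import Algebra.Definitions.RawSemiring as RawSemiringDefs
open import Data.Bool.Base using (Bool; true; false; T; if_then_else_; _∧_; _∨_; _xor_)
open import Data.Bool.Properties using (∧-comm; ∨-comm)
open import Data.Empty using (⊥-elim)
open import Data.Fin.Base using (Fin; zero; suc; toℕ; punchIn)
open import Data.Fin.Properties using (_≟_)
open import Data.Nat.Base as ℕ using (ℕ; zero; suc)
open import Data.Product.Base using (∃-syntax; _×_)
open import Data.Vec.Functional using (Vector)
open import Relation.Binary.Construct.Closure.ReflexiveTransitive using (Star)
open import Relation.Binary.PropositionalEquality using (_≡_; _≢_; refl; sym; trans; cong; cong₂)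
open import Relation.Nullary using (yes; no; does)

Matrix : ∀ {a} → Set a → ℕ → Set a
Matrix A n = Fin n → Fin n → A

record Graph (n : ℕ) : Set where
  field
    adj        : Fin n → Fin n → Bool
    adj-sym    : ∀ x y → adj x y ≡ adj y x
    adj-irrefl : ∀ x → adj x x ≡ false

  infix 4 _∼_
  _∼_ : Fin n → Fin n → Set
  x ∼ y = T (adj x y)

-- The entry of the adjacency matrix at (x , x) is the number of loops at
-- x, so a loop contributes 1 rather than 2.
record Pseudograph (n : ℕ) : Set where
  field
    matrix     : Matrix ℕ n
    matrix-sym : ∀ x y → matrix x y ≡ matrix y x

pseudo : ∀ {n} → Graph n → Pseudograph n
pseudo G = record
  { matrix     = λ x y → if adj x y then 1 else 0
  ; matrix-sym = λ x y → cong (if_then 1 else 0) (adj-sym x y)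
  }
  where open Graph G

adjacency : ∀ {n} → Graph n → Matrix ℕ n
adjacency G = Pseudograph.matrix (pseudo G)

Connected : ∀ {n} → Graph n → Set
Connected G = ∀ x y → Star (Graph._∼_ G) x y

module _ where
  open RawSemiringDefs ℕ.+-*-rawSemiring using (sum)

  power : ∀ {n} → Matrix ℕ n → ℕ → Matrix ℕ n
  power A zero    x y = if does (x ≟ y) then 1 else 0
  power A (suc ℓ) x y = sum λ z → A x z ℕ.* power A ℓ z y

WalkRegular : ∀ {n} → Graph n → Set
WalkRegular G = ∀ ℓ u v → power (adjacency G) ℓ u u ≡ power (adjacency G) ℓ v v

isPair : ∀ {n} → Fin n → Fin n → Fin n → Fin n → Bool
isPair u v x y = (does (x ≟ u) ∧ does (y ≟ v)) ∨ (does (x ≟ v) ∧ does (y ≟ u))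

isPair-sym : ∀ {n} (u v x y : Fin n) → isPair u v x y ≡ isPair u v y x
isPair-sym u v x y = trans
  (∨-comm (does (x ≟ u) ∧ does (y ≟ v)) (does (x ≟ v) ∧ does (y ≟ u)))
  (cong₂ _∨_ (∧-comm (does (x ≟ v)) (does (y ≟ u)))
             (∧-comm (does (x ≟ u)) (does (y ≟ v))))

isPair-irrefl : ∀ {n} {u v : Fin n} → u ≢ v → ∀ x → isPair u v x x ≡ false
isPair-irrefl {u = u} {v} u≢v x with x ≟ u | x ≟ v
... | yes x≡u | yes x≡v = ⊥-elim (u≢v (trans (sym x≡u) x≡v))
... | yes _   | no _    = refl
... | no _    | yes _   = refl
... | no _    | no _    = refl

-- G ± uv
flipEdge : ∀ {n} → Graph n → (u v : Fin n) → u ≢ v → Graph n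
flipEdge G u v u≢v = record
  { adj        = λ x y → isPair u v x y xor adj x y
  ; adj-sym    = λ x y → cong₂ _xor_ (isPair-sym u v x y) (adj-sym x y)
  ; adj-irrefl = λ x → cong₂ _xor_ (isPair-irrefl u≢v x) (adj-irrefl x)
  }
  where open Graph G

-- G_{u+v} for u ≢ v: the vertices other than v are enumerated by
-- punchIn v, and the one that was u plays the role of u+v.
amalgamate : ∀ {n} → Graph (suc n) → (u v : Fin (suc n)) → Pseudograph n
amalgamate {n} G u v = record
  { matrix     = λ i j → entry (punchIn v i) (punchIn v j)
  ; matrix-sym = λ i j → entry-sym (punchIn v i) (punchIn v j)
  }
  where
  a = adjacency G
  a-sym = Pseudograph.matrix-sym (pseudo G)

  entry : Fin (suc n) → Fin (suc n) → ℕ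
  entry x y =
    if does (x ≟ u)
    then (if does (y ≟ u) then a u v           else a u y ℕ.+ a v y)
    else (if does (y ≟ u) then a u x ℕ.+ a v x else a x y)

  entry-sym : ∀ x y → entry x y ≡ entry y x
  entry-sym x y with does (x ≟ u) | does (y ≟ u)
  ... | true  | true  = refl
  ... | true  | false = refl
  ... | false | true  = refl
  ... | false | false = a-sym x y

-- G + uūv, with ū as vertex zero
addCommonNeighbour : ∀ {n} → Graph n → (u v : Fin n) → Graph (suc n)
addCommonNeighbour {n} G u v = record
  { adj = adj′ ; adj-sym = adj′-sym ; adj-irrefl = adj′-irrefl }
  where
  open Graph G

  isEnd : Fin n → Bool
  isEnd x = does (x ≟ u) ∨ does (x ≟ v)

  adj′ : Fin (suc n) → Fin (suc n) → Bool
  adj′ zero    zero    = false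
  adj′ zero    (suc y) = isEnd y
  adj′ (suc x) zero    = isEnd x
  adj′ (suc x) (suc y) = adj x y

  adj′-sym : ∀ x y → adj′ x y ≡ adj′ y x
  adj′-sym zero    zero    = refl
  adj′-sym zero    (suc y) = refl
  adj′-sym (suc x) zero    = refl
  adj′-sym (suc x) (suc y) = adj-sym x y

  adj′-irrefl : ∀ x → adj′ x x ≡ false
  adj′-irrefl zero    = refl
  adj′-irrefl (suc x) = adj-irrefl x

module Determinant {c ℓ} (R : CommutativeRing c ℓ) where
  open CommutativeRing R hiding (zero)
  open RawSemiringDefs (Semiring.rawSemiring semiring) using (sum; _^_)

  det : ∀ {n} → Matrix Carrier n → Carrier
  det {zero}  M = 1#
  det {suc n} M = sum λ j →
    ((- 1#) ^ toℕ j) * M zero j * det (λ i k → M (suc i) (punchIn j k))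

-- The library has neither ℝ nor ℂ, so eigenvalues are taken in
-- an arbitrary algebraically closed field of characteristic zero.

module Spectrum {c ℓ₁ ℓ₂} (K : HeytingField c ℓ₁ ℓ₂) where
  open HeytingField K using (heytingCommutativeRing; _#_)
  commutativeRing : CommutativeRing c ℓ₁
  commutativeRing = HeytingCommutativeRing.commutativeRing heytingCommutativeRing
  open CommutativeRing commutativeRing hiding (zero; refl; sym; trans)
  open RawSemiringDefs (Semiring.rawSemiring semiring) using (sum; product; _^_) renaming (_×_ to _·_)
  open Determinant commutativeRing using (det)

  CharacteristicZero : Set ℓ₂
  CharacteristicZero = ∀ n → (suc n · 1#) # 0#

  -- Every monic polynomial Xⁿ⁺¹ + cₙXⁿ + … + c₁X + c₀ has a root.
  AlgebraicallyClosed : Set (c ⊔ ℓ₁)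
  AlgebraicallyClosed = ∀ n (cs : Vector Carrier (suc n)) →
    ∃[ x ] (x ^ suc n + sum (λ i → cs i * x ^ toℕ i)) ≈ 0#

  charPoly : ∀ {n} → Matrix ℕ n → Carrier → Carrier
  charPoly A x = det λ i j → (if does (i ≟ j) then x else 0#) - A i j · 1#

  -- λs lists the eigenvalues of A with (algebraic) multiplicity:
  -- det (X I − A) = ∏ᵢ (X − λᵢ).  Equality as functions on K is the same as
  -- equality of polynomials, K being infinite in characteristic zero.
  IsSpectrum : ∀ {n} → Matrix ℕ n → Vector Carrier n → Set (c ⊔ ℓ₁)
  IsSpectrum A λs = ∀ x → charPoly A x ≈ product (λ i → x - λs i)

  -- sp G = sp H: one and the same multiset of eigenvalues for both.
  SameSpectrum : ∀ {n} → Pseudograph n → Pseudograph n → Set (c ⊔ ℓ₁)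
  SameSpectrum G H = ∃[ λs ] IsSpectrum (Pseudograph.matrix G) λs
                           × IsSpectrum (Pseudograph.matrix H) λs

open Spectrum public using (CharacteristicZero; AlgebraicallyClosed; SameSpectrum)

{-# OPTIONS --safe #-}

-- Let φ = det M for M = x I − A, and let C be the matrix of cofactors of M.
-- Walk-regularity makes the diagonal of C constant, say ψ.  By Jacobi's
-- identity the principal cofactor D of order two at u, v satisfies
-- φ D = ψ² − c² with c = C u v, and expanding determinants by rows gives
--   G ± uv  :  φ + 2 t c − D              (t = 1 if u ∼ v, and −1 otherwise)
--   G_{u+v} :  2 ψ − 2 c − (x − a_uv) D
--   G + uūv :  x φ − 2 ψ − 2 c
-- as characteristic polynomials.  After multiplication by φ, the difference of
-- two of them for uv and wz is (C u v − C w z) times a polynomial with leading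
-- coefficient ±2.  Hence each of the three conditions says C u v = C w z.

module Submission where

open import Defs
open import Level using (_⊔_)
open import Algebra.Apartness.Bundles using (HeytingField)
open import Algebra.Bundles using (CommutativeRing; Semiring)
open import Algebra.Solver.Ring.AlmostCommutativeRing using (_-Raw-AlmostCommutative⟶_; fromCommutativeRing)
import Algebra.Definitions.RawMonoid
import Algebra.Definitions.RawSemiring
import Algebra.Properties.AbelianGroup
import Algebra.Properties.Ring
import Algebra.Properties.Semiring.Mult
import Algebra.Properties.Semiring.Sum
import Algebra.Solver.Ring
import Relation.Binary.Reasoning.Setoid
open import Data.Bool.Base using (Bool; true; false; T; if_then_else_; _∨_)
open import Data.Empty using (⊥-elim)
open import Data.Fin.Base using (Fin; zero; suc; toℕ; inject₁; punchIn; punchOut)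
open import Data.Fin.Properties using (_≟_; suc-injective; toℕ-inject₁; punchIn-injective; punchInᵢ≢i; punchIn-punchOut)
open import Data.Integer.Base as ℤ using (ℤ; +_; -[1+_]; _⊖_)
import Data.Integer.Properties as ℤ
open import Data.Maybe.Base using (Maybe; just; nothing)
open import Data.Nat.Base as ℕ using (ℕ; zero; suc; z≤n; s≤s)
import Data.Nat.Properties as ℕ
open import Data.Product.Base using (∃-syntax; _×_; _,_)
open import Data.Vec.Functional using (Vector; _∷_; tail; removeAt; updateAt)
open import Data.Vec.Functional.Properties using (updateAt-updates; updateAt-minimal; updateAt-commutes)
open import Function.Base using (_∘_; const)
open import Function.Bundles using (_⇔_; mk⇔; Equivalence)
open import Relation.Binary.PropositionalEquality as ≡ using (_≡_; _≢_)
open import Relation.Nullary using (yes; no; does)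

-- Since `φ` vanishes at the eigenvalues of `G`, it cannot be divided out pointwise: each such
-- division is a cancellation of polynomials. Equality in a Heyting field is not assumed decidable,
-- so the degree of a polynomial cannot be read off. A polynomial therefore carries a bound `d`
-- together with its coefficient at `xᵈ`, and from `f g = 0` one infers `f = 0` by showing that this
-- coefficient of `f` vanishes, lowering the bound and repeating. All this needs is a cancellable
-- leading coefficient of `g`.
--
-- Why walk-regularity fixes the diagonal of `C`: classically the diagonal entries of `C / φ` are
-- the generating functions of closed walks in `1 / x`. The series is avoided as follows. Let `f k`
-- be the difference of the diagonal entries of `C Aᵏ` at two vertices. Equal numbers of closed
-- walks give `f (k + 1) = x f k`, yet all `f k` obey the same degree bound, which forces them to
-- vanish.

-- Integer coefficients for the ring solver.

module IntegerCoefficients {c ℓ} (R : CommutativeRing c ℓ) where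
  open CommutativeRing R hiding (zero)
  open Algebra.Properties.Ring ring
  open Algebra.Properties.AbelianGroup +-abelianGroup using (⁻¹-∙-comm)
  open Algebra.Properties.Semiring.Mult semiring using (×-homo-+; ×1-homo-*) renaming (_×_ to _·_)
  open Relation.Binary.Reasoning.Setoid setoid

  fromℤ : ℤ → Carrier
  fromℤ (+ n)    = n · 1#
  fromℤ -[1+ n ] = - (suc n · 1#)

  fromℤ-neg : ∀ i → fromℤ (ℤ.- i) ≈ - fromℤ i
  fromℤ-neg (+ zero)   = sym -0#≈0#
  fromℤ-neg (+ suc n)  = refl
  fromℤ-neg -[1+ n ]   = sym (-‿involutive _)

  fromℤ-⊖ : ∀ m n → fromℤ (m ⊖ n) ≈ m · 1# - n · 1#
  fromℤ-⊖ m zero          = sym (trans (+-congˡ -0#≈0#) (+-identityʳ _))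
  fromℤ-⊖ zero (suc n)    = sym (+-identityˡ _)
  fromℤ-⊖ (suc m) (suc n) = begin
    fromℤ (suc m ⊖ suc n)              ≡⟨ ≡.cong fromℤ (ℤ.[1+m]⊖[1+n]≡m⊖n m n) ⟩
    fromℤ (m ⊖ n)                      ≈⟨ fromℤ-⊖ m n ⟩
    a - b                              ≈⟨ +-identityˡ _ ⟨
    0# + (a - b)                       ≈⟨ +-congʳ (-‿inverseʳ 1#) ⟨
    1# - 1# + (a - b)                  ≈⟨ +-assoc _ _ _ ⟩
    1# + (- 1# + (a - b))              ≈⟨ +-congˡ (+-assoc _ _ _) ⟨
    1# + ((- 1# + a) - b)              ≈⟨ +-congˡ (+-congʳ (+-comm _ _)) ⟩
    1# + ((a - 1#) - b)                ≈⟨ +-congˡ (+-assoc _ _ _) ⟩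
    1# + (a + (- 1# - b))              ≈⟨ +-assoc _ _ _ ⟨
    1# + a + (- 1# - b)                ≈⟨ +-congˡ (⁻¹-∙-comm 1# b) ⟩
    1# + a - (1# + b)                  ∎
    where
    a = m · 1#
    b = n · 1#

  fromℤ-+ : ∀ i j → fromℤ (i ℤ.+ j) ≈ fromℤ i + fromℤ j
  fromℤ-+ (+ m)    (+ n)    = ×-homo-+ 1# m n
  fromℤ-+ (+ m)    -[1+ n ] = fromℤ-⊖ m (suc n)
  fromℤ-+ -[1+ m ] (+ n)    = trans (fromℤ-⊖ n (suc m)) (+-comm _ _)
  fromℤ-+ -[1+ m ] -[1+ n ] = begin
    - (suc (suc (m ℕ.+ n)) · 1#)          ≡⟨ ≡.cong (λ k → - (suc k · 1#)) (ℕ.+-suc m n) ⟨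
    - ((suc m ℕ.+ suc n) · 1#)            ≈⟨ -‿cong (×-homo-+ 1# (suc m) (suc n)) ⟩
    - (suc m · 1# + suc n · 1#)           ≈⟨ ⁻¹-∙-comm _ _ ⟨
    - (suc m · 1#) - suc n · 1#           ∎

  fromℤ-*⁺ : ∀ m j → fromℤ (+ m ℤ.* j) ≈ fromℤ (+ m) * fromℤ j
  fromℤ-*⁺ m (+ n)    = trans (reflexive (≡.cong fromℤ (≡.sym (ℤ.pos-* m n)))) (×1-homo-* m n)
  fromℤ-*⁺ m -[1+ n ] = begin
    fromℤ (+ m ℤ.* -[1+ n ])        ≡⟨ ≡.cong fromℤ (ℤ.neg-distribʳ-* (+ m) (+ suc n)) ⟨
    fromℤ (ℤ.- (+ m ℤ.* + suc n))   ≈⟨ fromℤ-neg (+ m ℤ.* + suc n) ⟩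
    - fromℤ (+ m ℤ.* + suc n)       ≈⟨ -‿cong (fromℤ-*⁺ m (+ suc n)) ⟩
    - (fromℤ (+ m) * fromℤ (+ suc n)) ≈⟨ -‿distribʳ-* _ _ ⟩
    fromℤ (+ m) * fromℤ -[1+ n ]    ∎

  fromℤ-* : ∀ i j → fromℤ (i ℤ.* j) ≈ fromℤ i * fromℤ j
  fromℤ-* (+ m)    j = fromℤ-*⁺ m j
  fromℤ-* -[1+ m ] j = begin
    fromℤ (-[1+ m ] ℤ.* j)            ≡⟨ ≡.cong fromℤ (ℤ.neg-distribˡ-* (+ suc m) j) ⟨
    fromℤ (ℤ.- (+ suc m ℤ.* j))       ≈⟨ fromℤ-neg (+ suc m ℤ.* j) ⟩
    - fromℤ (+ suc m ℤ.* j)           ≈⟨ -‿cong (fromℤ-*⁺ (suc m) j) ⟩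
    - (fromℤ (+ suc m) * fromℤ j)     ≈⟨ -‿distribˡ-* _ _ ⟩
    fromℤ -[1+ m ] * fromℤ j          ∎

  fromℤ-morphism : ℤ.+-*-rawRing -Raw-AlmostCommutative⟶ fromCommutativeRing R
  fromℤ-morphism = record
    { ⟦_⟧    = fromℤ
    ; +-homo = fromℤ-+
    ; *-homo = fromℤ-*
    ; -‿homo = fromℤ-neg
    ; 0-homo = refl
    ; 1-homo = +-identityʳ 1#
    }

  -- Coefficients are compared in the integers, where equality is decidable even if it is not in
  -- `R`. This lets the solver cancel terms such as `x - x`.
  fromℤ-≟ : ∀ i j → Maybe (fromℤ i ≈ fromℤ j)
  fromℤ-≟ i j with i ℤ.≟ j
  ... | yes i≡j = just (reflexive (≡.cong fromℤ i≡j))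
  ... | no _    = nothing

  open Algebra.Solver.Ring ℤ.+-*-rawRing (fromCommutativeRing R) fromℤ-morphism fromℤ-≟ public
    using (solve; _:=_; _:+_; _:*_; _:-_; :-_)

-- Row replacement and the removal of two columns.

infixl 6 _[_]≔_
_[_]≔_ : ∀ {a} {A : Set a} {n} → Vector A n → Fin n → A → Vector A n
M [ i ]≔ r = updateAt M i (const r)

punchIn-inject₁ : ∀ {n} (i j : Fin n) → toℕ i ℕ.≤ toℕ j → punchIn (inject₁ i) j ≡ suc j
punchIn-inject₁ zero    j       _         = ≡.refl
punchIn-inject₁ (suc i) (suc j) (s≤s i≤j) = ≡.cong suc (punchIn-inject₁ i j i≤j)

punchIn-suc : ∀ {n} (i j : Fin n) → toℕ i ℕ.≤ toℕ j → punchIn (suc j) i ≡ inject₁ i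
punchIn-suc zero    j       _         = ≡.refl
punchIn-suc (suc i) (suc j) (s≤s i≤j) = ≡.cong suc (punchIn-suc i j i≤j)

-- Columns `i` and `j + 1` can be removed in either order, so the two summands of a double Laplace
-- expansion that belong to this pair of columns have the same minor.
punchIn-punchIn : ∀ {n} (i j : Fin (suc n)) (k : Fin n) → toℕ i ℕ.≤ toℕ j →
                  punchIn (inject₁ i) (punchIn j k) ≡ punchIn (suc j) (punchIn i k)
punchIn-punchIn zero    j       k       _         = ≡.refl
punchIn-punchIn (suc i) (suc j) zero    _         = ≡.refl
punchIn-punchIn (suc i) (suc j) (suc k) (s≤s i≤j) = ≡.cong suc (punchIn-punchIn i j k i≤j)

-- Alternating forms in the rows of a matrix.

module Multilinear {c ℓ} (R : CommutativeRing c ℓ) where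
  open CommutativeRing R hiding (zero)
  open Determinant R public using (det)
  open IntegerCoefficients R
  open Algebra.Definitions.RawSemiring (Semiring.rawSemiring semiring) using (_^_)
  open Algebra.Properties.Ring ring
  open Algebra.Properties.Semiring.Sum semiring
  open Relation.Binary.Reasoning.Setoid setoid

  sgn : ∀ {n} → Fin n → Carrier
  sgn i = (- 1#) ^ toℕ i

  δ : ∀ {n} → Fin n → Fin n → Carrier
  δ i j = if does (i ≟ j) then 1# else 0#

  δ-refl : ∀ {n} (i : Fin n) → δ i i ≡ 1#
  δ-refl zero    = ≡.refl
  δ-refl (suc i) = δ-refl i

  δ-≢ : ∀ {n} {i j : Fin n} → i ≢ j → δ i j ≡ 0#
  δ-≢ {i = i} {j} i≢j with i ≟ j
  ... | yes i≡j = ⊥-elim (i≢j i≡j)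
  ... | no _    = ≡.refl

  δ-sym : ∀ {n} (i j : Fin n) → δ i j ≡ δ j i
  δ-sym zero    zero    = ≡.refl
  δ-sym zero    (suc j) = ≡.refl
  δ-sym (suc i) zero    = ≡.refl
  δ-sym (suc i) (suc j) = δ-sym i j

  sum-0 : ∀ {n} {f : Vector Carrier n} → (∀ i → f i ≈ 0#) → sum f ≈ 0#
  sum-0 {n} f≈0 = trans (sum-cong-≋ f≈0) (sum-replicate-zero n)

  sum-*ˡ : ∀ {n} a (f : Vector Carrier n) → sum (λ i → a * f i) ≈ a * sum f
  sum-*ˡ a f = sym (*-distribˡ-sum a f)

  sum-δ : ∀ {n} (f : Vector Carrier n) i → sum (λ j → f j * δ j i) ≈ f i
  sum-δ f zero = begin
    f zero * 1# + sum (λ j → f (suc j) * 0#) ≈⟨ +-cong (*-identityʳ _) (sum-0 {f = λ j → f (suc j) * 0#} λ j → zeroʳ _) ⟩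
    f zero + 0#                              ≈⟨ +-identityʳ _ ⟩
    f zero                                   ∎
  sum-δ f (suc i) = trans (+-cong (zeroʳ _) (sum-δ (f ∘ suc) i)) (+-identityˡ _)

  sgn² : ∀ {n} (i : Fin n) → sgn i * sgn i ≈ 1#
  sgn² zero    = *-identityˡ 1#
  sgn² (suc i) = begin
    (- 1# * sgn i) * (- 1# * sgn i) ≈⟨ solve 2 (λ o s → (:- o :* s) :* (:- o :* s) := (o :* s) :* (o :* s)) refl 1# (sgn i) ⟩
    (1# * sgn i) * (1# * sgn i)     ≈⟨ *-cong (*-identityˡ _) (*-identityˡ _) ⟩
    sgn i * sgn i                   ≈⟨ sgn² i ⟩
    1#                              ∎

  sgn-suc : ∀ {n} (i : Fin n) → sgn (suc i) ≈ - sgn i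
  sgn-suc i = trans (sym (-‿distribˡ-* _ _)) (-‿cong (*-identityˡ _))

  Rows : ℕ → ℕ → Set c
  Rows n m = Fin n → Fin m → Carrier

  infix 4 _≋_
  _≋_ : ∀ {n m} → Rows n m → Rows n m → Set ℓ
  M ≋ N = ∀ i j → M i j ≈ N i j

  -- The number of rows may differ from their length because fixing the top row of a form leaves a
  -- form in fewer rows. `linear` relates three families up to `≈` instead of naming an updated
  -- matrix, so pointwise equality suffices. `adjacent` asks only about neighbouring rows, the case
  -- that Laplace expansion settles directly; `vanish` recovers the rest.
  record Alternating {n m} (D : Rows n m → Carrier) : Set (c ⊔ ℓ) where
    field
      form-cong : ∀ {M N} → M ≋ N → D M ≈ D N
      linear    : ∀ i a {M N P} → (∀ j → P i j ≈ M i j + a * N i j) →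
                  (∀ k → k ≢ i → ∀ j → P k j ≈ M k j) →
                  (∀ k → k ≢ i → ∀ j → P k j ≈ N k j) →
                  D P ≈ D M + a * D N
      adjacent  : ∀ i j → toℕ j ≡ suc (toℕ i) → ∀ {M} →
                  (∀ k → M i k ≈ M j k) → D M ≈ 0#
  open Alternating

  ∷-congʳ : ∀ {n m} {r : Fin m → Carrier} {M N : Rows n m} → M ≋ N → (r ∷ M) ≋ (r ∷ N)
  ∷-congʳ M≋N zero    j = refl
  ∷-congʳ M≋N (suc i) j = M≋N i j

  ∷-alternating : ∀ {n m} {D : Rows (suc n) m → Carrier} → Alternating D →
                  ∀ r → Alternating (λ N → D (r ∷ N))
  ∷-alternating alt r .form-cong M≋N = form-cong alt (∷-congʳ M≋N)
  ∷-alternating alt r .linear i a {M} {N} {P} at-i off-M off-N =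
    linear alt (suc i) a at-i (off off-M) (off off-N)
    where
    off : ∀ {M} → (∀ k → k ≢ i → ∀ j → P k j ≈ M k j) →
          ∀ k → k ≢ suc i → ∀ j → (r ∷ P) k j ≈ (r ∷ M) k j
    off h zero    _   j = refl
    off h (suc k) k≢i j = h k (k≢i ∘ ≡.cong suc) j
  ∷-alternating alt r .adjacent i j i∼j = adjacent alt (suc i) (suc j) (≡.cong suc i∼j)

  ≔-same : ∀ {n m} (M : Rows n m) i {r} j → (M [ i ]≔ r) i j ≈ r j
  ≔-same M i j = reflexive (≡.cong-app (updateAt-updates i M) j)

  ≔-other : ∀ {n m} (M : Rows n m) i {r} k → k ≢ i → ∀ j → (M [ i ]≔ r) k j ≈ M k j
  ≔-other M i k k≢i j = reflexive (≡.cong-app (updateAt-minimal k i M k≢i) j)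

  ≔-≋ : ∀ {n m} {M N : Rows n m} i {r} → (∀ j → r j ≈ N i j) →
        (∀ k → k ≢ i → ∀ j → M k j ≈ N k j) → (M [ i ]≔ r) ≋ N
  ≔-≋ {M = M} i at-i off k j with k ≟ i
  ... | yes ≡.refl = trans (≔-same M i j) (at-i j)
  ... | no k≢i     = trans (≔-other M i k k≢i j) (off k k≢i j)

  ≔-≔-≋ : ∀ {n m} {M N : Rows n m} i i′ {r s} → (∀ j → r j ≈ N i j) → (∀ j → s j ≈ N i′ j) →
          (∀ k → k ≢ i → k ≢ i′ → ∀ j → M k j ≈ N k j) → (M [ i ]≔ r [ i′ ]≔ s) ≋ N
  ≔-≔-≋ {n} {m} {M} {N} i i′ {r} at-i at-i′ off = ≔-≋ i′ at-i′ other
    where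
    other : ∀ k → k ≢ i′ → ∀ j → (M [ i ]≔ r) k j ≈ N k j
    other k k≢i′ j with k ≟ i
    ... | yes ≡.refl = trans (≔-same M i j) (at-i j)
    ... | no k≢i     = trans (≔-other M i k k≢i j) (off k k≢i k≢i′ j)

  ≔-id : ∀ {n m} {M : Rows n m} i → (M [ i ]≔ M i) ≋ M
  ≔-id i = ≔-≋ i (λ j → refl) (λ k _ j → refl)

  ≔-cong : ∀ {n m} {M : Rows n m} i {r s} → (∀ j → r j ≈ s j) → (M [ i ]≔ r) ≋ (M [ i ]≔ s)
  ≔-cong {M = M} i r≈s = ≔-≋ i (λ j → trans (r≈s j) (sym (≔-same M i j)))
                               (λ k k≢i j → sym (≔-other M i k k≢i j))

  module _ {n m} {D : Rows n m → Carrier} (alt : Alternating D) where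

    linear-≔ : ∀ {M} i {r s} a →
               D (M [ i ]≔ (λ j → r j + a * s j)) ≈ D (M [ i ]≔ r) + a * D (M [ i ]≔ s)
    linear-≔ {M} i a = linear alt i a
      (λ j → trans (≔-same M i j) (sym (+-cong (≔-same M i j) (*-congˡ (≔-same M i j)))))
      (λ k k≢i j → trans (≔-other M i k k≢i j) (sym (≔-other M i k k≢i j)))
      (λ k k≢i j → trans (≔-other M i k k≢i j) (sym (≔-other M i k k≢i j)))

    -- A zero row satisfies `r = r - r`, so linearity applies with all three families equal to `M`.
    zero-row : ∀ {M} i → (∀ j → M i j ≈ 0#) → D M ≈ 0#
    zero-row {M} i Mi≈0 = begin
      D M              ≈⟨ linear alt i (- 1#) (λ j → row j) (λ _ _ _ → refl) (λ _ _ _ → refl) ⟩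
      D M + - 1# * D M ≈⟨ +-congˡ (-1*x≈-x (D M)) ⟩
      D M - D M        ≈⟨ -‿inverseʳ (D M) ⟩
      0#               ∎
      where
      row : ∀ j → M i j ≈ M i j + - 1# * M i j
      row j = trans (sym (+-identityʳ _)) (+-congˡ (sym (trans (*-congˡ (Mi≈0 j)) (zeroʳ _))))

    add-≔ : ∀ {M} i {r s} →
            D (M [ i ]≔ (λ j → r j + s j)) ≈ D (M [ i ]≔ r) + D (M [ i ]≔ s)
    add-≔ {M} i {r} {s} = begin
      D (M [ i ]≔ (λ j → r j + s j))            ≈⟨ form-cong alt (≔-cong i λ j → +-congˡ (*-identityˡ _)) ⟨
      D (M [ i ]≔ (λ j → r j + 1# * s j))       ≈⟨ linear-≔ i 1# ⟩
      D (M [ i ]≔ r) + 1# * D (M [ i ]≔ s)      ≈⟨ +-congˡ (*-identityˡ _) ⟩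
      D (M [ i ]≔ r) + D (M [ i ]≔ s)           ∎

    neg-≔ : ∀ {M} i {r s} →
            D (M [ i ]≔ (λ j → r j - s j)) ≈ D (M [ i ]≔ r) - D (M [ i ]≔ s)
    neg-≔ {M} i {r} {s} = begin
      D (M [ i ]≔ (λ j → r j - s j))            ≈⟨ form-cong alt (≔-cong i λ j → +-congˡ (-1*x≈-x _)) ⟨
      D (M [ i ]≔ (λ j → r j + - 1# * s j))     ≈⟨ linear-≔ i (- 1#) ⟩
      D (M [ i ]≔ r) + - 1# * D (M [ i ]≔ s)    ≈⟨ +-congˡ (-1*x≈-x _) ⟩
      D (M [ i ]≔ r) - D (M [ i ]≔ s)           ∎

    sum-≔ : ∀ {M} i {p} (a : Vector Carrier p) (r : Rows p m) →
            D (M [ i ]≔ (λ j → sum (λ k → a k * r k j))) ≈ sum (λ k → a k * D (M [ i ]≔ r k))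
    sum-≔ {M} i {zero} a r = zero-row i (≔-same M i)
    sum-≔ {M} i {suc p} a r = begin
      D (M [ i ]≔ (λ j → a zero * r zero j + S j))        ≈⟨ form-cong alt (≔-cong i λ j → +-comm _ _) ⟩
      D (M [ i ]≔ (λ j → S j + a zero * r zero j))        ≈⟨ linear-≔ i (a zero) ⟩
      D (M [ i ]≔ S) + a zero * D (M [ i ]≔ r zero)       ≈⟨ +-comm _ _ ⟩
      a zero * D (M [ i ]≔ r zero) + D (M [ i ]≔ S)       ≈⟨ +-congˡ (sum-≔ i (tail a) (tail r)) ⟩
      sum (λ k → a k * D (M [ i ]≔ r k))                  ∎
      where
      S : Fin m → Carrier
      S j = sum (λ k → a (suc k) * r (suc k) j)

  -- Polarisation: expand `Q (r + s) (r + s) = 0`. The two slots are abstract so that they can be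
  -- the two top rows, as in `swap`, or any two rows, as in `exchange`.
  skew : ∀ {m} (Q : (r s : Fin m → Carrier) → Carrier) → (∀ r → Q r r ≈ 0#) →
         (∀ r s t → Q (λ j → r j + s j) t ≈ Q r t + Q s t) →
         (∀ r s t → Q r (λ j → s j + t j) ≈ Q r s + Q r t) →
         ∀ r s → Q r s ≈ - Q s r
  skew Q repeated addˡ addʳ r s = begin
    Q r s                            ≈⟨ solve 4 (λ a b c d → b := (a :+ b) :+ (c :+ d) :- a :- c :- d) refl (Q r r) (Q r s) (Q s r) (Q s s) ⟩
    (Q r r + Q r s) + (Q s r + Q s s) - Q r r - Q s r - Q s s
      ≈⟨ +-cong (+-congʳ (+-cong expand (-‿cong (repeated r)))) (-‿cong (repeated s)) ⟩
    0# - 0# - Q s r - 0#             ≈⟨ solve 2 (λ z c → z :- z :- c :- z := (:- c) :- z) refl 0# (Q s r) ⟩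
    - Q s r - 0#                     ≈⟨ trans (+-congˡ -0#≈0#) (+-identityʳ _) ⟩
    - Q s r                          ∎
    where
    expand : (Q r r + Q r s) + (Q s r + Q s s) ≈ 0#
    expand = begin
      (Q r r + Q r s) + (Q s r + Q s s)             ≈⟨ +-cong (addʳ r r s) (addʳ s r s) ⟨
      Q r (λ j → r j + s j) + Q s (λ j → r j + s j) ≈⟨ addˡ r s _ ⟨
      Q (λ j → r j + s j) (λ j → r j + s j)         ≈⟨ repeated _ ⟩
      0#                                            ∎

  add-∷ : ∀ {n m} {D : Rows (suc n) m → Carrier} → Alternating D →
          ∀ r s T → D ((λ j → r j + s j) ∷ T) ≈ D (r ∷ T) + D (s ∷ T)
  add-∷ alt r s T = trans
    (linear alt zero 1# (λ j → +-congˡ (sym (*-identityˡ _)))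
      (λ { zero 0≢0 → ⊥-elim (0≢0 ≡.refl) ; (suc k) _ j → refl })
      (λ { zero 0≢0 → ⊥-elim (0≢0 ≡.refl) ; (suc k) _ j → refl }))
    (+-congˡ (*-identityˡ _))

  swap : ∀ {n m} {D : Rows (suc (suc n)) m → Carrier} → Alternating D →
         ∀ r s T → D (r ∷ s ∷ T) ≈ - D (s ∷ r ∷ T)
  swap {D = D} alt r s T = skew (λ x y → D (x ∷ y ∷ T))
    (λ x → adjacent alt zero (suc zero) ≡.refl (λ k → refl))
    (λ x y z → add-∷ alt x y (z ∷ T))
    (λ x y z → add-∷ (∷-alternating alt x) y z T)
    r s

  -- Row `i` passes the `i` rows above it one at a time, each passage contributing a factor `-1`;
  -- the other rows keep their order.
  move-to-top : ∀ {n m} {D : Rows (suc n) m → Carrier} → Alternating D →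
                ∀ i M → D M ≈ sgn i * D (M i ∷ removeAt M i)
  move-to-top alt zero M = trans
    (form-cong alt (λ { zero j → refl ; (suc k) j → refl }))
    (sym (*-identityˡ _))
  move-to-top {suc n} {D = D} alt (suc i) M = begin
    D M                                                       ≈⟨ form-cong alt (λ { zero j → refl ; (suc k) j → refl }) ⟩
    D (M zero ∷ tail M)                                       ≈⟨ move-to-top (∷-alternating alt (M zero)) i (tail M) ⟩
    sgn i * D (M zero ∷ M (suc i) ∷ removeAt (tail M) i)      ≈⟨ *-congˡ (swap alt _ _ _) ⟩
    sgn i * - D (M (suc i) ∷ M zero ∷ removeAt (tail M) i)    ≈⟨ solve 2 (λ s d → s :* (:- d) := (:- s) :* d) refl (sgn i) _ ⟩
    - sgn i * D (M (suc i) ∷ M zero ∷ removeAt (tail M) i)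
      ≈⟨ *-cong (sym (sgn-suc i)) (form-cong alt (∷-congʳ λ { zero j → refl ; (suc k) j → refl })) ⟩
    sgn (suc i) * D (M (suc i) ∷ removeAt M (suc i))          ∎

  -- Both rows are brought to the top, where they are neighbours.
  vanish : ∀ {n m} {D : Rows n m → Carrier} → Alternating D →
           ∀ {i j} → i ≢ j → ∀ {M} → (∀ k → M i k ≈ M j k) → D M ≈ 0#
  vanish {suc zero}    alt {zero} {zero} i≢j eq = ⊥-elim (i≢j ≡.refl)
  vanish {suc (suc n)} {D = D} alt {i} {j} i≢j {M} eq = begin
    D M                                                  ≈⟨ move-to-top alt i M ⟩
    sgn i * D (M i ∷ N)                                  ≈⟨ *-congˡ (move-to-top (∷-alternating alt (M i)) j′ N) ⟩
    sgn i * (sgn j′ * D (M i ∷ N j′ ∷ removeAt N j′))    ≈⟨ *-congˡ (*-congˡ (adjacent alt zero (suc zero) ≡.refl eq′)) ⟩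
    sgn i * (sgn j′ * 0#)                                ≈⟨ trans (*-congˡ (zeroʳ _)) (zeroʳ _) ⟩
    0#                                                   ∎
    where
    N : Rows (suc n) _
    N = removeAt M i
    j′ : Fin (suc n)
    j′ = punchOut i≢j
    eq′ : ∀ k → M i k ≈ N j′ k
    eq′ k = trans (eq k) (reflexive (≡.cong (λ l → M l k) (≡.sym (punchIn-punchOut i≢j))))

  ≔-commutes : ∀ {n m} (M : Rows n m) {i j} → i ≢ j → ∀ {r s} →
               (M [ i ]≔ r [ j ]≔ s) ≋ (M [ j ]≔ s [ i ]≔ r)
  ≔-commutes M {i} {j} i≢j k l = reflexive (≡.cong-app (updateAt-commutes j i (i≢j ∘ ≡.sym) M k) l)

  exchange : ∀ {n m} {D : Rows n m → Carrier} → Alternating D →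
             ∀ {i j} → i ≢ j → ∀ {M r s} →
             D (M [ i ]≔ r [ j ]≔ s) ≈ - D (M [ i ]≔ s [ j ]≔ r)
  exchange {D = D} alt {i} {j} i≢j {M} {r} {s} = skew (λ x y → D (M [ i ]≔ x [ j ]≔ y))
    (λ x → vanish alt i≢j λ k → trans
      (trans (≔-other (M [ i ]≔ x) j i i≢j k) (≔-same M i k))
      (sym (≔-same (M [ i ]≔ x) j k)))
    (λ x y z → trans (trans (form-cong alt (≔-commutes M i≢j)) (add-≔ alt i))
      (sym (+-cong (form-cong alt (≔-commutes M i≢j)) (form-cong alt (≔-commutes M i≢j)))))
    (λ x y z → add-≔ alt j)
    r s

  -- By linearity the multiples of `r` are removed row by row, and each term with `r` itself as a
  -- row vanishes. The hypothesis speaks of `E` because `E` will be `D (r ∷ _)`, where the second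
  -- copy of `r` is not among the rows of `N`.
  absorb : ∀ {n m} {E : Rows n m → Carrier} → Alternating E → ∀ (r : Fin m → Carrier) →
           (∀ N i → (∀ j → r j ≈ N i j) → E N ≈ 0#) →
           ∀ {P N} (a : Fin n → Carrier) → (∀ i j → P i j ≈ N i j + a i * r j) → E P ≈ E N
  absorb {zero}  alt r vanishing a eq = form-cong alt λ ()
  absorb {suc n} {E = E} alt r vanishing {P} {N} a eq = begin
    E P                                          ≈⟨ linear alt zero (a zero) (eq zero) P-off-zero P-off-zero ⟩
    E (N zero ∷ tail P) + a zero * E (r ∷ tail P) ≈⟨ +-congˡ (trans (*-congˡ (vanishing _ zero λ j → refl)) (zeroʳ _)) ⟩
    E (N zero ∷ tail P) + 0#                     ≈⟨ +-identityʳ _ ⟩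
    E (N zero ∷ tail P)
      ≈⟨ absorb (∷-alternating alt (N zero)) r (λ T i → vanishing (N zero ∷ T) (suc i)) (tail a) (eq ∘ suc) ⟩
    E (N zero ∷ tail N)                          ≈⟨ form-cong alt (λ { zero j → refl ; (suc k) j → refl }) ⟩
    E N                                          ∎
    where
    P-off-zero : ∀ {x} k → k ≢ zero → ∀ j → P k j ≈ (x ∷ tail P) k j
    P-off-zero zero    k≢0 j = ⊥-elim (k≢0 ≡.refl)
    P-off-zero (suc k) _   j = refl

  -- The determinant as an alternating form, and its multiplicativity.

  minor : ∀ {n} → Rows (suc n) (suc n) → Fin (suc n) → Rows n n
  minor M j i k = M (suc i) (punchIn j k)

  laplace : ∀ {n} → Rows (suc n) (suc n) → Fin (suc n) → Carrier
  laplace M j = sgn j * M zero j * det (minor M j)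

  det-cong : ∀ {n} {M N : Rows n n} → M ≋ N → det M ≈ det N
  det-cong {zero}  M≋N = refl
  det-cong {suc n} {M} {N} M≋N = sum-cong-≋ {x = laplace M} {laplace N} λ j →
    *-cong (*-congˡ (M≋N zero j)) (det-cong λ i k → M≋N (suc i) (punchIn j k))

  det-linear : ∀ {n} i a {M N P : Rows n n} → (∀ j → P i j ≈ M i j + a * N i j) →
               (∀ k → k ≢ i → ∀ j → P k j ≈ M k j) →
               (∀ k → k ≢ i → ∀ j → P k j ≈ N k j) →
               det P ≈ det M + a * det N
  det-linear {suc n} i a {M} {N} {P} at-i off-M off-N = begin
    sum (laplace P)                            ≈⟨ sum-cong-≋ (summand i at-i off-M off-N) ⟩
    sum (λ j → laplace M j + a * laplace N j)  ≈⟨ ∑-distrib-+ (laplace M) (λ j → a * laplace N j) ⟩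
    det M + sum (λ j → a * laplace N j)        ≈⟨ +-congˡ (sum-*ˡ a (laplace N)) ⟩
    det M + a * det N                          ∎
    where
    summand : ∀ i → (∀ j → P i j ≈ M i j + a * N i j) →
              (∀ k → k ≢ i → ∀ j → P k j ≈ M k j) →
              (∀ k → k ≢ i → ∀ j → P k j ≈ N k j) → ∀ j →
              laplace P j ≈
              laplace M j + a * laplace N j
    summand zero at-i off-M off-N j = begin
      laplace P j                     ≈⟨ *-congʳ (*-congˡ (at-i j)) ⟩
      sgn j * (M zero j + a * N zero j) * det (minor P j)
        ≈⟨ solve 5 (λ s m a n d → s :* (m :+ a :* n) :* d := s :* m :* d :+ a :* (s :* n :* d)) refl (sgn j) (M zero j) a (N zero j) _ ⟩
      sgn j * M zero j * det (minor P j) + a * (sgn j * N zero j * det (minor P j))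
        ≈⟨ +-cong (*-congˡ (det-cong λ k l → off-M (suc k) (λ ()) _)) (*-congˡ (*-congˡ (det-cong λ k l → off-N (suc k) (λ ()) _))) ⟩
      laplace M j + a * laplace N j ∎
    summand (suc i) at-i off-M off-N j = begin
      laplace P j
        ≈⟨ *-congˡ (det-linear i a (λ k → at-i _) (λ k k≢i l → off-M (suc k) (k≢i ∘ suc-injective) _) (λ k k≢i l → off-N (suc k) (k≢i ∘ suc-injective) _)) ⟩
      sgn j * P zero j * (det (minor M j) + a * det (minor N j))
        ≈⟨ solve 5 (λ s p a m n → s :* p :* (m :+ a :* n) := s :* p :* m :+ a :* (s :* p :* n)) refl (sgn j) (P zero j) a _ _ ⟩
      sgn j * P zero j * det (minor M j) + a * (sgn j * P zero j * det (minor N j))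
        ≈⟨ +-cong (*-congʳ (*-congˡ (off-M zero (λ ()) j))) (*-congˡ (*-congʳ (*-congˡ (off-N zero (λ ()) j)))) ⟩
      laplace M j + a * laplace N j ∎

  -- The summands of a double Laplace expansion, indexed by the first column
  -- and the remaining second one, cancel in pairs.
  sum-antisymmetric : ∀ {n} (f : Fin (suc n) → Fin n → Carrier) →
    (∀ i j → toℕ i ℕ.≤ toℕ j → f (inject₁ i) j + f (suc j) i ≈ 0#) →
    sum (λ i → sum (f i)) ≈ 0#
  sum-antisymmetric {zero}  f anti = +-identityʳ 0#
  sum-antisymmetric {suc n} f anti = begin
    sum (f zero) + sum (λ i → f (suc i) zero + sum (λ j → f (suc i) (suc j)))
      ≈⟨ +-congˡ (∑-distrib-+ (λ i → f (suc i) zero) (λ i → sum (λ j → f (suc i) (suc j)))) ⟩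
    sum (f zero) + (sum (λ i → f (suc i) zero) + sum (λ i → sum (λ j → f (suc i) (suc j))))
      ≈⟨ +-assoc _ _ _ ⟨
    sum (f zero) + sum (λ i → f (suc i) zero) + sum (λ i → sum (λ j → f (suc i) (suc j)))
      ≈⟨ +-cong (sym (∑-distrib-+ (f zero) (λ i → f (suc i) zero))) (sum-antisymmetric (λ i j → f (suc i) (suc j)) λ i j i≤j → anti (suc i) (suc j) (s≤s i≤j)) ⟩
    sum (λ i → f zero i + f (suc i) zero) + 0#   ≈⟨ +-identityʳ _ ⟩
    sum (λ i → f zero i + f (suc i) zero)        ≈⟨ sum-0 (λ i → anti zero i z≤n) ⟩
    0#                                           ∎

  -- Equal rows below the first persist in every minor. If the first two rows agree, expanding along
  -- both gives summands that cancel for each unordered pair of columns.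
  det-adjacent : ∀ {n} (i j : Fin n) → toℕ j ≡ suc (toℕ i) → ∀ {M : Rows n n} →
                 (∀ k → M i k ≈ M j k) → det M ≈ 0#
  det-adjacent {suc n} (suc i) (suc j) i∼j {M} eq = sum-0 {f = laplace M} λ k → trans
    (*-congˡ (det-adjacent i j (ℕ.suc-injective i∼j) {minor M k} λ l → eq _)) (zeroʳ _)
  det-adjacent {suc (suc n)} zero (suc zero) _ {M} eq = begin
    sum (λ i → sgn i * M zero i * sum (g i))
      ≈⟨ sum-cong-≋ {x = λ i → sum (f i)} (λ i → sum-*ˡ (sgn i * M zero i) (g i)) ⟨
    sum (λ i → sum (f i))   ≈⟨ sum-antisymmetric f cancel ⟩
    0#                      ∎
    where
    X f g : Fin (suc (suc n)) → Fin (suc n) → Carrier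
    X i j = det (λ k l → M (suc (suc k)) (punchIn i (punchIn j l)))
    g i j = sgn j * M (suc zero) (punchIn i j) * X i j
    f i j = sgn i * M zero i * g i j

    -- Once column `i` is gone, column `j + 1` is number `j` among the others, while removing
    -- `j + 1` leaves the number of `i` unchanged. The signs thus differ by exactly one factor `-1`.
    cancel : ∀ i j → toℕ i ℕ.≤ toℕ j → f (inject₁ i) j + f (suc j) i ≈ 0#
    cancel i j i≤j = begin
      f (inject₁ i) j + f (suc j) i
        ≈⟨ +-cong (*-cong (*-congʳ (reflexive (≡.cong ((- 1#) ^_) (toℕ-inject₁ i))))
                    (*-congʳ (*-congˡ (reflexive (≡.cong (M (suc zero)) (punchIn-inject₁ i j i≤j))))))
                  (*-cong (*-cong (sgn-suc j) (eq (suc j)))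
                    (*-cong (*-congˡ (trans (reflexive (≡.cong (M (suc zero)) (punchIn-suc i j i≤j))) (sym (eq (inject₁ i)))))
                      (sym (det-cong λ k l → reflexive (≡.cong (M (suc (suc k))) (punchIn-punchIn i j l i≤j)))))) ⟩
      sgn i * a * (sgn j * b * X (inject₁ i) j) + - sgn j * b * (sgn i * a * X (inject₁ i) j)
        ≈⟨ solve 5 (λ s t a b x → s :* a :* (t :* b :* x) :+ (:- t) :* b :* (s :* a :* x) := x :- x) refl (sgn i) (sgn j) a b _ ⟩
      X (inject₁ i) j - X (inject₁ i) j   ≈⟨ -‿inverseʳ _ ⟩
      0#                                  ∎
      where
      a b : Carrier
      a = M zero (inject₁ i)
      b = M (suc zero) (suc j)

  det-alternating : ∀ {n} → Alternating (det {n})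
  det-alternating = record { form-cong = det-cong ; linear = det-linear ; adjacent = det-adjacent }

  -- Uniqueness of alternating forms; `D = det` gives multiplicativity. The statement is about any
  -- `D` because the induction passes to `D (b k ∷ _)`, which is no longer a determinant of a square
  -- matrix.
  alternating-det : ∀ {n m} {D : Rows n m → Carrier} → Alternating D → ∀ (M : Rows n n) (b : Rows n m) →
            D (λ i j → sum (λ k → M i k * b k j)) ≈ det M * D b
  alternating-det {zero}  alt M b = trans (form-cong alt λ ()) (sym (*-identityˡ _))
  alternating-det {suc n} {D = D} alt M b = begin
    D Mb                                           ≈⟨ form-cong alt (≔-id zero) ⟨
    D (Mb [ zero ]≔ Mb zero)                       ≈⟨ sum-≔ alt zero (M zero) b ⟩
    sum (λ k → M zero k * D (Mb [ zero ]≔ b k))    ≈⟨ sum-cong-≋ summand ⟩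
    sum (λ k → laplace M k * D b)                  ≈⟨ *-distribʳ-sum (D b) (laplace M) ⟨
    det M * D b                                    ∎
    where
    Mb : Rows (suc n) _
    Mb i j = sum (λ k → M i k * b k j)

    -- With `b k` on top, the components of the remaining rows along `b k` do not matter; dropping
    -- them deletes column `k` of `M`.
    reduce : ∀ k → D (b k ∷ tail Mb) ≈ det (minor M k) * D (b k ∷ removeAt b k)
    reduce k = trans
      (absorb (∷-alternating alt (b k)) (b k)
        (λ N i eq → vanish alt {zero} {suc i} (λ ()) eq)
        (λ i → M (suc i) k)
        (λ i j → trans (sum-remove {i = k} (λ l → M (suc i) l * b l j)) (+-comm _ _)))
      (alternating-det (∷-alternating alt (b k)) (minor M k) (removeAt b k))

    summand : ∀ k → M zero k * D (Mb [ zero ]≔ b k) ≈ laplace M k * D b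
    summand k = begin
      m * D (Mb [ zero ]≔ b k)
        ≈⟨ *-congˡ (trans (form-cong alt λ { zero j → refl ; (suc i) j → refl }) (reduce k)) ⟩
      -- The sign is inserted twice: one copy completes the Laplace summand, the other returns `b k`
      -- to its place in `b`.
      m * (d * e)                     ≈⟨ *-congˡ (*-congˡ (*-identityˡ _)) ⟨
      m * (d * (1# * e))              ≈⟨ *-congˡ (*-congˡ (*-congʳ (sgn² k))) ⟨
      m * (d * (sgn k * sgn k * e))   ≈⟨ solve 4 (λ m d s e → m :* (d :* (s :* s :* e)) := s :* m :* d :* (s :* e)) refl m d (sgn k) e ⟩
      sgn k * m * d * (sgn k * e)     ≈⟨ *-congˡ (move-to-top alt k b) ⟨
      sgn k * m * d * D b             ∎
      where
      m d e : Carrier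
      m = M zero k
      d = det (minor M k)
      e = D (b k ∷ removeAt b k)

-- Cofactors, Jacobi's identity and determinants after row changes.

module Cofactors {c ℓ} (R : CommutativeRing c ℓ) where
  open CommutativeRing R hiding (zero)
  open IntegerCoefficients R
  open Multilinear R
  open Alternating
  open Algebra.Properties.Ring ring
  open Algebra.Properties.Semiring.Sum semiring
  open Relation.Binary.Reasoning.Setoid setoid

  sum-δˡ : ∀ {n} (f : Vector Carrier n) i → sum (λ j → δ i j * f j) ≈ f i
  sum-δˡ f i = trans
    (sum-cong-≋ λ j → trans (*-comm _ _) (*-congˡ (reflexive (δ-sym i j))))
    (sum-δ f i)

  scale-≔ : ∀ {n m} {D : Rows n m → Carrier} → Alternating D →
            ∀ {M} i a {r} → D (M [ i ]≔ (λ j → a * r j)) ≈ a * D (M [ i ]≔ r)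
  scale-≔ {D = D} alt {M} i a {r} = begin
    D (M [ i ]≔ (λ j → a * r j))                    ≈⟨ form-cong alt (≔-cong i λ j → +-identityˡ _) ⟨
    D (M [ i ]≔ (λ j → 0# + a * r j))               ≈⟨ linear-≔ alt i a ⟩
    D (M [ i ]≔ (λ j → 0#)) + a * D (M [ i ]≔ r)    ≈⟨ +-congʳ (zero-row alt i (≔-same M i)) ⟩
    0# + a * D (M [ i ]≔ r)                         ≈⟨ +-identityˡ _ ⟩
    a * D (M [ i ]≔ r)                              ∎

  -- The sign from moving row `i` to the top cancels the sign of column `i` in the Laplace
  -- expansion.
  det-unit-row : ∀ {n} {M : Rows (suc n) (suc n)} i → (∀ j → M i j ≈ δ i j) →
                 det M ≈ det (λ k l → M (punchIn i k) (punchIn i l))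
  det-unit-row {M = M} i Mi≈δ = begin
    det M                                        ≈⟨ move-to-top det-alternating i M ⟩
    sgn i * sum (laplace N)                      ≈⟨ *-congˡ (sum-cong-≋ {x = laplace N} λ j → trans (*-congʳ (trans (*-congˡ (Mi≈δ j)) (*-comm _ _))) (*-assoc _ _ _)) ⟩
    sgn i * sum (λ j → δ i j * (sgn j * d j))    ≈⟨ *-congˡ (sum-δˡ (λ j → sgn j * d j) i) ⟩
    sgn i * (sgn i * d i)                        ≈⟨ *-assoc _ _ _ ⟨
    sgn i * sgn i * d i                          ≈⟨ *-congʳ (sgn² i) ⟩
    1# * d i                                     ≈⟨ *-identityˡ _ ⟩
    d i                                          ∎
    where
    N : Rows (suc _) (suc _)
    N = M i ∷ removeAt M i
    d : Fin (suc _) → Carrier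
    d j = det (minor N j)

  det-identity : ∀ {n} → det {n} δ ≈ 1#
  det-identity {zero}  = refl
  det-identity {suc n} = trans (det-unit-row {n} {δ} zero λ j → refl) (det-identity {n})

  -- A column operation is right multiplication by an elementary matrix `E`, so multiplicativity
  -- handles it without transposing anything.
  det-add-column : ∀ {n} (M : Rows n n) {u v} → u ≢ v →
                   det (λ i j → M i j + M i v * δ u j) ≈ det M
  det-add-column {n} M {u} {v} u≢v = begin
    det (λ i j → M i j + M i v * δ u j)        ≈⟨ det-cong product ⟨
    det (λ i j → sum (λ k → M i k * E k j))    ≈⟨ alternating-det det-alternating M E ⟩
    det M * det E                              ≈⟨ *-congˡ det-E ⟩
    det M * 1#                                 ≈⟨ *-identityʳ _ ⟩
    det M                                      ∎
    where
    E : Rows _ _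
    E k j = δ k j + δ v k * δ u j

    product : ∀ i j → sum (λ k → M i k * E k j) ≈ M i j + M i v * δ u j
    product i j = begin
      sum (λ k → M i k * E k j)
        ≈⟨ sum-cong-≋ (λ k → trans (distribˡ _ _ _) (+-congˡ (solve 3 (λ m a b → m :* (a :* b) := a :* (m :* b)) refl (M i k) (δ v k) (δ u j)))) ⟩
      sum (λ k → M i k * δ k j + δ v k * (M i k * δ u j))
        ≈⟨ ∑-distrib-+ (λ k → M i k * δ k j) _ ⟩
      sum (λ k → M i k * δ k j) + sum (λ k → δ v k * (M i k * δ u j))
        ≈⟨ +-cong (sum-δ (M i) j) (sum-δˡ (λ k → M i k * δ u j) v) ⟩
      M i j + M i v * δ u j                    ∎

    det-E : det E ≈ 1#
    det-E = begin
      det E                                    ≈⟨ det-cong (λ k j → sym (≔-≋ v (λ j → sym (+-congˡ (trans (*-congʳ (reflexive (δ-refl v))) (*-identityˡ _)))) (λ k k≢v j → sym (trans (+-congˡ (trans (*-congʳ (reflexive (δ-≢ (k≢v ∘ ≡.sym)))) (zeroˡ _))) (+-identityʳ _))) k j)) ⟩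
      det (δ [ v ]≔ (λ j → δ v j + δ u j))     ≈⟨ add-≔ det-alternating v ⟩
      det (δ [ v ]≔ δ v) + det (δ [ v ]≔ δ u)
        ≈⟨ +-cong (trans (det-cong (≔-id v)) (det-identity {n}))
                  (vanish det-alternating u≢v λ k → trans (≔-other δ v u u≢v k) (sym (≔-same δ v k))) ⟩
      1# + 0#                                  ≈⟨ +-identityʳ _ ⟩
      1#                                       ∎

  -- A unit row takes the place of a signed minor, so that expansions along a row are instances of
  -- linearity.
  cofactor : ∀ {n} → Rows n n → Rows n n
  cofactor M i j = det (M [ i ]≔ δ j)

  det-≔ : ∀ {n} (M : Rows n n) i r → det (M [ i ]≔ r) ≈ sum (λ j → r j * cofactor M i j)
  det-≔ M i r = trans
    (det-cong (≔-cong i λ j → sym (sum-δ r j)))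
    (sum-≔ det-alternating i r δ)

  cramer : ∀ {n} (M : Rows n n) i k → sum (λ j → M k j * cofactor M i j) ≈ δ i k * det M
  cramer M i k = trans (sym (det-≔ M i (M k))) value
    where
    value : det (M [ i ]≔ M k) ≈ δ i k * det M
    value with i ≟ k
    ... | yes ≡.refl = trans (det-cong (≔-id i)) (sym (*-identityˡ _))
    ... | no i≢k     = trans
      (vanish det-alternating i≢k λ l → trans (≔-same M i l) (sym (≔-other M i k (i≢k ∘ ≡.sym) l)))
      (sym (zeroˡ _))

  module _ {n} (M : Rows n n) {u v : Fin n} (u≢v : u ≢ v) where
    private
      C : Rows n n
      C = cofactor M
      v≢u : v ≢ u
      v≢u = u≢v ∘ ≡.sym

    cofactor₂ : Carrier
    cofactor₂ = det (M [ u ]≔ δ u [ v ]≔ δ v)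

    det-≔-own : ∀ {i j r} → i ≢ j → det (M [ i ]≔ r [ j ]≔ M j) ≈ det (M [ i ]≔ r)
    det-≔-own {i} {j} {r} i≢j = det-cong (≔-≋ j
      (λ l → sym (≔-other M i j (i≢j ∘ ≡.sym) l)) (λ k _ l → refl))

    -- Both changed rows are expanded by linearity. The term with `δ v` in row `u` and `δ u` in row
    -- `v` is one exchange away from `cofactor₂`, hence the sign of the quadratic term.
    det-flip : ∀ t → det (M [ u ]≔ (λ j → M u j + t * δ v j) [ v ]≔ (λ j → M v j + t * δ u j))
                     ≈ det M + t * C u v + t * (C v u - t * cofactor₂)
    det-flip t = begin
      det (M [ u ]≔ (λ j → M u j + t * δ v j) [ v ]≔ (λ j → M v j + t * δ u j))
        ≈⟨ linear-≔ det-alternating v t ⟩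
      det (M [ u ]≔ (λ j → M u j + t * δ v j) [ v ]≔ M v) + t * det (M [ u ]≔ (λ j → M u j + t * δ v j) [ v ]≔ δ u)
        ≈⟨ +-cong first (*-congˡ second) ⟩
      det M + t * C u v + t * (C v u - t * cofactor₂) ∎
      where
      first : det (M [ u ]≔ (λ j → M u j + t * δ v j) [ v ]≔ M v) ≈ det M + t * C u v
      first = trans (det-≔-own u≢v)
        (trans (linear-≔ det-alternating u t) (+-congʳ (det-cong (≔-id u))))
      second : det (M [ u ]≔ (λ j → M u j + t * δ v j) [ v ]≔ δ u) ≈ C v u - t * cofactor₂
      second = begin
        det (M [ u ]≔ (λ j → M u j + t * δ v j) [ v ]≔ δ u)  ≈⟨ det-cong (≔-commutes M u≢v) ⟩
        det (M [ v ]≔ δ u [ u ]≔ (λ j → M u j + t * δ v j))  ≈⟨ linear-≔ det-alternating u t ⟩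
        det (M [ v ]≔ δ u [ u ]≔ M u) + t * det (M [ v ]≔ δ u [ u ]≔ δ v)
          ≈⟨ +-cong (det-≔-own v≢u) (*-congˡ (trans (det-cong (≔-commutes M v≢u)) (exchange det-alternating u≢v))) ⟩
        C v u + t * - cofactor₂                              ≈⟨ +-congˡ (-‿distribʳ-* _ _) ⟨
        C v u - t * cofactor₂                                ∎

    -- By `inverse`, `det M` times the unit row `δ v` is a combination of the rows of `M`. Put into
    -- row `v` beside `δ u` in row `u`, it leaves only the summands of rows `u` and `v`. The
    -- hypothesis is the column form of `cramer`, which the row arguments do not give for a general
    -- matrix.
    jacobi : (∀ j → sum (λ k → C k v * M k j) ≈ det M * δ v j) →
             det M * cofactor₂ ≈ C u u * C v v - C u v * C v u
    jacobi inverse = begin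
      det M * cofactor₂                                ≈⟨ scale-≔ det-alternating v (det M) ⟨
      det (N [ v ]≔ (λ j → det M * δ v j))             ≈⟨ det-cong (≔-cong v inverse) ⟨
      det (N [ v ]≔ (λ j → sum (λ k → C k v * M k j))) ≈⟨ sum-≔ det-alternating v (λ k → C k v) M ⟩
      sum (λ k → C k v * det (N [ v ]≔ M k))
        ≈⟨ sum-cong-≋ (λ k → trans (*-congˡ (value k)) (solve 5 (λ c a b d e → c :* (a :* b :- d :* e) := a :* (b :* c) :+ d :* (c :* (:- e))) refl (C k v) (δ v k) (C u u) (δ u k) (C v u))) ⟩
      sum (λ k → δ v k * (C u u * C k v) + δ u k * (C k v * - C v u))
        ≈⟨ ∑-distrib-+ (λ k → δ v k * (C u u * C k v)) _ ⟩
      sum (λ k → δ v k * (C u u * C k v)) + sum (λ k → δ u k * (C k v * - C v u))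
        ≈⟨ +-cong (sum-δˡ (λ k → C u u * C k v) v) (sum-δˡ (λ k → C k v * - C v u) u) ⟩
      C u u * C v v + C u v * - C v u                  ≈⟨ +-congˡ (-‿distribʳ-* _ _) ⟨
      C u u * C v v - C u v * C v u                    ∎
      where
      N : Rows n n
      N = M [ u ]≔ δ u
      -- Row `v` in its own place gives `C u u`, row `u` gives `- C v u` after an exchange, and any
      -- other row occurs twice.
      value : ∀ k → det (N [ v ]≔ M k) ≈ δ v k * C u u - δ u k * C v u
      value k with v ≟ k | u ≟ k
      ... | yes ≡.refl | yes u≡v = ⊥-elim (u≢v u≡v)
      ... | yes ≡.refl | no _ = trans (det-≔-own u≢v)
        (sym (trans (+-cong (*-identityˡ _) (trans (-‿cong (zeroˡ _)) -0#≈0#)) (+-identityʳ _)))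
      ... | no _ | yes ≡.refl = trans
        (trans (exchange det-alternating u≢v) (-‿cong (trans (det-cong (≔-commutes M u≢v)) (det-≔-own v≢u))))
        (sym (trans (+-cong (zeroˡ _) (-‿cong (*-identityˡ _))) (+-identityˡ _)))
      ... | no v≢k | no u≢k = trans
        (vanish det-alternating v≢k λ l → trans (≔-same N v l)
          (sym (trans (≔-other N v k (v≢k ∘ ≡.sym) l) (≔-other M u k (u≢k ∘ ≡.sym) l))))
        (sym (trans (+-cong (zeroˡ _) (trans (-‿cong (zeroˡ _)) -0#≈0#)) (+-identityʳ _)))

    -- These are the rows that amalgamation produces in `merged`. On expansion, the only
    -- second-order term without two equal rows is `cofactor₂`.
    det-merge : ∀ y → det (M [ u ]≔ (λ j → M u j + M v j - y * δ u j) [ v ]≔ (λ j → δ v j - δ u j))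
                      ≈ C u u + C v v - C u v - C v u - y * cofactor₂
    det-merge y = begin
      det (M [ u ]≔ r [ v ]≔ (λ j → δ v j - δ u j))            ≈⟨ neg-≔ det-alternating v ⟩
      det (M [ u ]≔ r [ v ]≔ δ v) - det (M [ u ]≔ r [ v ]≔ δ u) ≈⟨ +-cong (row-u v) (-‿cong (row-u u)) ⟩
      (C v v - C u v - y * det (M [ v ]≔ δ v [ u ]≔ δ u)) - (C v u - C u u - y * det (M [ v ]≔ δ u [ u ]≔ δ u))
        ≈⟨ +-cong (+-congˡ (-‿cong (*-congˡ (det-cong (≔-commutes M v≢u))))) (-‿cong (+-congˡ (trans (-‿cong (trans (*-congˡ repeated) (zeroʳ y))) -0#≈0#))) ⟩
      (C v v - C u v - y * cofactor₂) - (C v u - C u u + 0#)   ≈⟨ +-congˡ (-‿cong (+-identityʳ _)) ⟩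
      (C v v - C u v - y * cofactor₂) - (C v u - C u u)
        ≈⟨ solve 5 (λ a b c d e → (b :- c :- e) :- (d :- a) := a :+ b :- c :- d :- e) refl (C u u) (C v v) (C u v) (C v u) (y * cofactor₂) ⟩
      C u u + C v v - C u v - C v u - y * cofactor₂            ∎
      where
      r : Fin n → Carrier
      r j = M u j + M v j - y * δ u j

      repeated : det (M [ v ]≔ δ u [ u ]≔ δ u) ≈ 0#
      repeated = vanish det-alternating v≢u λ k → trans
        (trans (≔-other (M [ v ]≔ δ u) u v v≢u k) (≔-same M v k))
        (sym (≔-same (M [ v ]≔ δ u) u k))

      row-u : ∀ w → det (M [ u ]≔ r [ v ]≔ δ w) ≈ C v w - C u w - y * det (M [ v ]≔ δ w [ u ]≔ δ u)
      row-u w = begin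
        det (M [ u ]≔ r [ v ]≔ δ w)                         ≈⟨ det-cong (≔-commutes M u≢v) ⟩
        det (N [ u ]≔ r)                                    ≈⟨ neg-≔ det-alternating u ⟩
        det (N [ u ]≔ (λ j → M u j + M v j)) - det (N [ u ]≔ (λ j → y * δ u j))
          ≈⟨ +-cong (add-≔ det-alternating u) (-‿cong (scale-≔ det-alternating u y)) ⟩
        det (N [ u ]≔ M u) + det (N [ u ]≔ M v) - y * det (N [ u ]≔ δ u)
          ≈⟨ +-congʳ (+-cong (det-≔-own v≢u) (trans (exchange det-alternating v≢u) (-‿cong (trans (det-cong (≔-commutes M v≢u)) (det-≔-own u≢v))))) ⟩
        C v w - C u w - y * det (N [ u ]≔ δ u)              ∎
        where
        N : Rows n n
        N = M [ v ]≔ δ w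

  -- A Schur complement without division: `a` times the top row plus the combination `y` of the
  -- lower rows is zero except in the corner.
  det-bordered : ∀ {n} (S : Rows (suc n) (suc n)) (b y : Fin n → Carrier) a →
    (∀ j → S zero (suc j) ≈ - b j) → (∀ i → S (suc i) zero ≈ - b i) →
    (∀ j → sum (λ i → y i * S (suc i) (suc j)) ≈ a * b j) →
    a * det S ≈ (a * S zero zero - sum (λ i → y i * b i)) * det (λ i j → S (suc i) (suc j))
  det-bordered S b y a top left eliminate = begin
    a * det S                                       ≈⟨ *-congˡ (det-cong {M = S [ zero ]≔ S zero} (≔-id zero)) ⟨
    a * det (S [ zero ]≔ S zero)                    ≈⟨ +-identityˡ _ ⟨
    0# + a * det (S [ zero ]≔ S zero)               ≈⟨ +-congʳ lower-rows ⟨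
    det (S [ zero ]≔ w) + a * det (S [ zero ]≔ S zero) ≈⟨ linear-≔ det-alternating {S} zero {w} {S zero} a ⟨
    det S′                                          ≈⟨ +-cong (*-congʳ (trans (*-identityˡ _) corner)) (sum-0 {f = λ j → laplace S′ (suc j)} (λ j → trans (*-congʳ (trans (*-congˡ (rest j)) (zeroʳ _))) (zeroˡ _))) ⟩
    (a * S zero zero - sum (λ i → y i * b i)) * det (λ i j → S (suc i) (suc j)) + 0# ≈⟨ +-identityʳ _ ⟩
    (a * S zero zero - sum (λ i → y i * b i)) * det (λ i j → S (suc i) (suc j)) ∎
    where
    w : Fin (suc _) → Carrier
    w j = sum (λ i → y i * S (suc i) j)

    S′ : Rows (suc _) (suc _)
    S′ = S [ zero ]≔ (λ j → w j + a * S zero j)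

    lower-rows : det (S [ zero ]≔ w) ≈ 0#
    lower-rows = trans (sum-≔ det-alternating {S} zero y (tail S)) (sum-0 {f = λ i → y i * det (S [ zero ]≔ S (suc i))} λ i →
      trans (*-congˡ (vanish det-alternating {zero} {suc i} (λ ()) {S [ zero ]≔ S (suc i)} λ k → refl)) (zeroʳ _))

    corner : w zero + a * S zero zero ≈ a * S zero zero - sum (λ i → y i * b i)
    corner = trans (+-comm _ _) (+-congˡ (begin
      w zero                          ≈⟨ sum-cong-≋ (λ i → trans (*-congˡ (left i)) (trans (sym (-‿distribʳ-* _ _)) (sym (-1*x≈-x _)))) ⟩
      sum (λ i → - 1# * (y i * b i))  ≈⟨ sum-*ˡ (- 1#) (λ i → y i * b i) ⟩
      - 1# * sum (λ i → y i * b i)    ≈⟨ -1*x≈-x _ ⟩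
      - sum (λ i → y i * b i)         ∎))

    rest : ∀ j → w (suc j) + a * S zero (suc j) ≈ 0#
    rest j = begin
      w (suc j) + a * S zero (suc j)  ≈⟨ +-cong (eliminate j) (trans (*-congˡ (top j)) (sym (-‿distribʳ-* _ _))) ⟩
      a * b j - a * b j               ≈⟨ -‿inverseʳ _ ⟩
      0#                              ∎

-- Polynomial functions with a degree bound.

module Polynomials {c ℓ} (R : CommutativeRing c ℓ) where
  open CommutativeRing R hiding (zero)
  open IntegerCoefficients R
  open Multilinear R
  open Algebra.Definitions.RawSemiring (Semiring.rawSemiring semiring) using (_^_; product)
  open Algebra.Properties.Ring ring
  open Algebra.Properties.Semiring.Mult semiring using (×-homo-+) renaming (_×_ to _·_)
  open Algebra.Properties.Semiring.Sum semiring
  open Relation.Binary.Reasoning.Setoid setoid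

  -- f x = a xᵈ + (terms of lower degree), in Horner form; a may be zero.
  Polynomial : ℕ → Carrier → (Carrier → Carrier) → Set (c ⊔ ℓ)
  Polynomial zero    a f = ∀ x → f x ≈ a
  Polynomial (suc d) a f = ∃[ k ] ∃[ g ] Polynomial d a g × (∀ x → f x ≈ k + x * g x)

  private variable
    d e : ℕ
    a b : Carrier
    f g h : Carrier → Carrier

  poly-cong : a ≈ b → (∀ x → f x ≈ g x) → Polynomial d a f → Polynomial d b g
  poly-cong {d = zero}  a≈b f≈g p x = trans (sym (f≈g x)) (trans (p x) a≈b)
  poly-cong {d = suc d} a≈b f≈g (k , q , p , eq) =
    k , q , poly-cong a≈b (λ _ → refl) p , λ x → trans (sym (f≈g x)) (eq x)

  poly-raise : Polynomial d a f → Polynomial (suc d) 0# f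
  poly-raise {zero}  {a} p =
    a , (λ _ → 0#) , (λ _ → refl) , λ x → trans (p x) (sym (trans (+-congˡ (zeroʳ x)) (+-identityʳ a)))
  poly-raise {suc d} (k , q , p , eq) = k , q , poly-raise p , eq

  poly-0 : ∀ d → Polynomial d 0# (λ _ → 0#)
  poly-0 zero    = λ _ → refl
  poly-0 (suc d) = poly-raise (poly-0 d)

  poly-x* : Polynomial d a f → Polynomial (suc d) a (λ x → x * f x)
  poly-x* {f = f} p = 0# , f , p , λ x → sym (+-identityˡ _)

  poly-+ : Polynomial d a f → Polynomial d b g → Polynomial d (a + b) (λ x → f x + g x)
  poly-+ {zero}  p q x = +-cong (p x) (q x)
  poly-+ {suc d} (k , r , p , eq) (l , s , q , eq′) =
    k + l , (λ x → r x + s x) , poly-+ p q , λ x → trans (+-cong (eq x) (eq′ x))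
      (solve 5 (λ k l x r s → (k :+ x :* r) :+ (l :+ x :* s) := (k :+ l) :+ x :* (r :+ s)) refl k l x (r x) (s x))

  poly-scale : ∀ k → Polynomial d a f → Polynomial d (k * a) (λ x → k * f x)
  poly-scale {zero}  k p x = *-congˡ (p x)
  poly-scale {suc d} k (l , r , p , eq) =
    k * l , (λ x → k * r x) , poly-scale k p , λ x → trans (*-congˡ (eq x))
      (solve 4 (λ k l x r → k :* (l :+ x :* r) := k :* l :+ x :* (k :* r)) refl k l x (r x))

  poly-neg : Polynomial d a f → Polynomial d (- a) (λ x → - f x)
  poly-neg p = poly-cong (-1*x≈-x _) (λ x → -1*x≈-x _) (poly-scale (- 1#) p)

  poly-raise-by : ∀ d → Polynomial e a f → Polynomial (suc d ℕ.+ e) 0# f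
  poly-raise-by zero    p = poly-raise p
  poly-raise-by (suc d) p = poly-raise (poly-raise-by d p)

  poly-* : Polynomial d a f → Polynomial e b g → Polynomial (d ℕ.+ e) (a * b) (λ x → f x * g x)
  poly-* {zero}  p q = poly-cong refl (λ x → *-congʳ (sym (p x))) (poly-scale _ q)
  poly-* {suc d} {f = f} {g = g} (k , r , p , eq) q = poly-cong (+-identityˡ _)
    (λ x → sym (trans (*-congʳ (eq x)) (solve 4 (λ k x r g → (k :+ x :* r) :* g := k :* g :+ x :* (r :* g)) refl k x (r x) (g x))))
    (poly-+ (poly-raise-by d (poly-scale k q)) (poly-x* (poly-* p q)))

  poly-sum : ∀ {n} {a : Vector Carrier n} {f : Fin n → Carrier → Carrier} →
             (∀ i → Polynomial d (a i) (f i)) → Polynomial d (sum a) (λ x → sum (λ i → f i x))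
  poly-sum {d} {zero}  p = poly-0 d
  poly-sum {d} {suc n} {a} {f} p = poly-+ (p zero) (poly-sum {n = n} {tail a} {tail f} (λ i → p (suc i)))

  -- `L` collects the coefficients of `x` in the entries; only products of these reach degree `n` in
  -- the Laplace expansion.
  poly-det : ∀ {n} (L : Rows n n) (M : Carrier → Rows n n) →
             (∀ i j → Polynomial 1 (L i j) (λ x → M x i j)) →
             Polynomial n (det L) (λ x → det (M x))
  poly-det {zero}  L M p x = refl
  poly-det {suc n} L M p = poly-sum {a = laplace L} {f = λ j x → laplace (M x) j} λ j →
    poly-* {1} (poly-scale (sgn j) (p zero j))
      (poly-det (minor L j) (λ x → minor (M x) j) λ i k → p (suc i) _)

  poly-lower : Polynomial (suc d) a f → a ≈ 0# → ∃[ b ] Polynomial d b f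
  poly-lower {zero} {a} (k , r , p , eq) a≈0 = k , λ x → trans (eq x)
    (trans (+-congˡ (trans (*-congˡ (trans (p x) a≈0)) (zeroʳ x))) (+-identityʳ k))
  poly-lower {suc d} (k , r , p , eq) a≈0 =
    let b , q = poly-lower p a≈0 in b , k , r , q , eq

  -- Synthetic division on the Horner form. The remainder is kept because `μ` need not be a root,
  -- and the leading coefficient passes to the quotient unchanged, so monic stays monic.
  poly-divide : Polynomial (suc d) a f → ∀ μ →
                ∃[ q ] Polynomial d a q × (∀ x → f x ≈ (x - μ) * q x + f μ)
  poly-divide {zero} {a} {f} (k , r , p , eq) μ = r , p , λ x → begin
    f x                                ≈⟨ eq x ⟩
    k + x * r x                        ≈⟨ solve 4 (λ k x m r → k :+ x :* r := (x :- m) :* r :+ (k :+ m :* r)) refl k x μ (r x) ⟩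
    (x - μ) * r x + (k + μ * r x)      ≈⟨ +-congˡ (+-congˡ (*-congˡ (trans (p x) (sym (p μ))))) ⟩
    (x - μ) * r x + (k + μ * r μ)      ≈⟨ +-congˡ (eq μ) ⟨
    (x - μ) * r x + f μ                ∎
  poly-divide {suc d} {a} {f} (k , r , p , eq) μ with poly-divide p μ
  ... | q , p′ , eq′ = (λ x → r μ + x * q x) , (r μ , q , p′ , λ _ → refl) , λ x → begin
    f x                                            ≈⟨ trans (eq x) (+-congˡ (*-congˡ (eq′ x))) ⟩
    k + x * ((x - μ) * q x + r μ)
      ≈⟨ solve 5 (λ k x m q s → k :+ x :* ((x :- m) :* q :+ s) := (x :- m) :* (s :+ x :* q) :+ (k :+ m :* s)) refl k x μ (q x) (r μ) ⟩
    (x - μ) * (r μ + x * q x) + (k + μ * r μ)      ≈⟨ +-congˡ (eq μ) ⟨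
    (x - μ) * (r μ + x * q x) + f μ                ∎

  -- Converts Horner form to the coefficient vector in which algebraic closedness is phrased.
  poly-expand : Polynomial d a f → ∃[ cs ] (∀ x → f x ≈ a * x ^ d + sum {d} (λ i → cs i * x ^ toℕ i))
  poly-expand {zero}  {a} p = (λ ()) , λ x → trans (p x) (sym (trans (+-identityʳ _) (*-identityʳ a)))
  poly-expand {suc d} {a} {f} (k , r , p , eq) with poly-expand p
  ... | cs , eq′ = (k ∷ cs) , λ x → begin
    f x                                                               ≈⟨ trans (eq x) (+-congˡ (*-congˡ (eq′ x))) ⟩
    k + x * (a * x ^ d + sum (λ i → cs i * x ^ toℕ i))
      ≈⟨ solve 5 (λ k x a p s → k :+ x :* (a :* p :+ s) := a :* (x :* p) :+ (k :+ x :* s)) refl k x a (x ^ d) _ ⟩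
    a * x ^ suc d + (k + x * sum (λ i → cs i * x ^ toℕ i))
      ≈⟨ +-congˡ (+-cong (sym (*-identityʳ k)) (trans (sym (sum-*ˡ x (λ i → cs i * x ^ toℕ i)))
           (sum-cong-≋ λ i → solve 3 (λ x c p → x :* (c :* p) := c :* (x :* p)) refl x (cs i) (x ^ toℕ i)))) ⟩
    a * x ^ suc d + sum (λ i → (k ∷ cs) i * x ^ toℕ i)                ∎

  poly-splits : (∀ n (cs : Vector Carrier (suc n)) → ∃[ x ] (x ^ suc n + sum (λ i → cs i * x ^ toℕ i)) ≈ 0#) →
                Polynomial d 1# f → ∃[ λs ] (∀ x → f x ≈ product {d} (λ i → x - λs i))
  poly-splits {zero}  root p = (λ ()) , p
  poly-splits {suc d} {f} root p =
    let cs , expansion = poly-expand p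
        μ , μ-root     = root d cs
        q , q-monic , division = poly-divide p μ
        λs , split     = poly-splits root q-monic
        fμ≈0 = trans (expansion μ) (trans (+-congʳ (*-identityˡ _)) μ-root)
    in (μ ∷ λs) , λ x → trans (division x) (trans (+-cong (*-congˡ (split x)) fμ≈0) (+-identityʳ _))

  -- The part of characteristic zero that cancellation uses, phrased without apartness so that it
  -- makes sense in a commutative ring.
  TorsionFree : Set (c ⊔ ℓ)
  TorsionFree = ∀ n {y} → (suc n · 1#) * y ≈ 0# → y ≈ 0#

  module Cancellation (torsion-free : TorsionFree) where

    -- Divide by `x - m`: at the point `m + k + 1` the divisor is the integer `k + 1`, which
    -- torsion-freeness removes, so the quotient vanishes at all integers from `m + 1` on and has
    -- the same leading coefficient.
    leading≈0 : Polynomial d a f → ∀ m → (∀ k → f ((k ℕ.+ m) · 1#) ≈ 0#) → a ≈ 0#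
    leading≈0 {zero}  p m f≈0 = trans (sym (p _)) (f≈0 0)
    leading≈0 {suc d} {f = f} p m f≈0 with poly-divide p (m · 1#)
    ... | q , p′ , eq = leading≈0 p′ (suc m) λ k → torsion-free k (begin
      (suc k · 1#) * q ((k ℕ.+ suc m) · 1#)
        ≈⟨ *-cong (difference k) (reflexive (≡.cong (λ i → q (i · 1#)) (ℕ.+-suc k m))) ⟩
      ((suc k ℕ.+ m) · 1# - m · 1#) * q ((suc k ℕ.+ m) · 1#)            ≈⟨ +-identityʳ _ ⟨
      ((suc k ℕ.+ m) · 1# - m · 1#) * q ((suc k ℕ.+ m) · 1#) + 0#       ≈⟨ +-congˡ (f≈0 0) ⟨
      ((suc k ℕ.+ m) · 1# - m · 1#) * q ((suc k ℕ.+ m) · 1#) + f (m · 1#) ≈⟨ eq _ ⟨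
      f ((suc k ℕ.+ m) · 1#)                                            ≈⟨ f≈0 (suc k) ⟩
      0#                                                                ∎)
      where
      difference : ∀ k → suc k · 1# ≈ (suc k ℕ.+ m) · 1# - m · 1#
      difference k = sym (trans (+-congʳ (×-homo-+ 1# (suc k) m))
        (trans (+-assoc _ _ _) (trans (+-congˡ (-‿inverseʳ _)) (+-identityʳ _))))

    leading-unique : Polynomial d a f → Polynomial d b f → a ≈ b
    leading-unique {a = a} {b = b} p q = begin
      a              ≈⟨ +-identityʳ a ⟨
      a + 0#         ≈⟨ +-congˡ (-‿inverseˡ b) ⟨
      a + (- b + b)  ≈⟨ +-assoc a (- b) b ⟨
      a - b + b      ≈⟨ +-congʳ (leading≈0 (poly-+ p (poly-neg q)) 0 λ k → -‿inverseʳ _) ⟩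
      0# + b         ≈⟨ +-identityˡ b ⟩
      b              ∎

    -- The top coefficient of the product is `a * b`, so `a` vanishes and the bound on `f` drops.
    -- The function `f` stays the same throughout the descent; only the bound changes.
    *-cancel : Polynomial d a f → Polynomial e b g → (∀ {y} → y * b ≈ 0# → y ≈ 0#) →
               (∀ x → f x * g x ≈ 0#) → ∀ x → f x ≈ 0#
    *-cancel {d} p q cancel fg≈0 = go d p
      where
      go : ∀ d {a} → Polynomial d a _ → ∀ x → _ ≈ 0#
      lead : ∀ {d a} → Polynomial d a _ → a ≈ 0#
      lead p = cancel (leading≈0 (poly-* p q) 0 λ k → fg≈0 _)
      go zero    p x = trans (p x) (lead p)
      go (suc d) p = go d (let _ , p′ = poly-lower p (lead p) in p′)

    shift-bounded : ∀ d (f : ℕ → Carrier → Carrier) → (∀ k → ∃[ a ] Polynomial d a (f k)) →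
                    (∀ k x → f (suc k) x ≈ x * f k x) → ∀ k x → f k x ≈ 0#
    -- Comparing f (suc k) = x · f k in degree d + 1 kills the coefficient of xᵈ.
    shift-bounded d f bounded shift = go d bounded
      where
      lead : ∀ {d k a b} → Polynomial d a (f k) → Polynomial d b (f (suc k)) → a ≈ 0#
      lead p q = leading-unique (poly-x* p) (poly-cong refl (shift _) (poly-raise q))
      go : ∀ d → (∀ k → ∃[ a ] Polynomial d a (f k)) → ∀ k x → f k x ≈ 0#
      go zero bounded k x =
        let a , p = bounded k
            b , q = bounded (suc k)
        in trans (p x) (lead p q)
      go (suc d) bounded = go d λ k →
        let a , p = bounded k
            b , q = bounded (suc k)
        in poly-lower p (lead p q)

-- Characteristic matrices and the cofactors of a symmetric one.

module CharacteristicMatrices {c ℓ} (R : CommutativeRing c ℓ) where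
  open CommutativeRing R hiding (zero)
  open IntegerCoefficients R
  open Multilinear R
  open Cofactors R
  open Polynomials R
  open Algebra.Properties.Semiring.Mult semiring using (×-homo-+; ×1-homo-*) renaming (_×_ to _·_)
  open Algebra.Properties.Semiring.Sum semiring
  open Relation.Binary.Reasoning.Setoid setoid

  private
    module ℕΣ = Algebra.Definitions.RawMonoid ℕ.+-0-rawMonoid

  sum-·1 : ∀ {n} (f : Fin n → ℕ) → ℕΣ.sum f · 1# ≈ sum (λ i → f i · 1#)
  sum-·1 {zero}  f = refl
  sum-·1 {suc n} f = trans (×-homo-+ 1# (f zero) _) (+-congˡ (sum-·1 (f ∘ suc)))

  charMatrix : ∀ {n} → Matrix ℕ n → Carrier → Rows n n
  charMatrix A x i j = (if does (i ≟ j) then x else 0#) - A i j · 1#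

  charMatrix-δ : ∀ {n} (A : Matrix ℕ n) x i j → charMatrix A x i j ≈ x * δ i j - A i j · 1#
  charMatrix-δ A x i j with does (i ≟ j)
  ... | true  = +-congʳ (sym (*-identityʳ x))
  ... | false = +-congʳ (sym (zeroʳ x))

  charMatrix-poly : ∀ {n} (A : Matrix ℕ n) i j → Polynomial 1 (δ i j) (λ x → charMatrix A x i j)
  charMatrix-poly A i j =
    - (A i j · 1#) , (λ _ → δ i j) , (λ _ → refl) , λ x → trans (charMatrix-δ A x i j) (+-comm _ _)

  charPoly-monic : ∀ {n} (A : Matrix ℕ n) → Polynomial n 1# (λ x → det (charMatrix A x))
  charPoly-monic {n} A = poly-cong (det-identity {n}) (λ _ → refl)
    (poly-det δ (charMatrix A) (charMatrix-poly A))

  module SymmetricMatrix (torsion-free : TorsionFree) {n} (A : Matrix ℕ (suc n))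
    (A-sym : ∀ i j → A i j ≡ A j i) where
    open Cancellation torsion-free

    φ : Carrier → Carrier
    φ x = det (charMatrix A x)

    C : Carrier → Rows (suc n) (suc n)
    C x = cofactor (charMatrix A x)

    φ-monic : Polynomial (suc n) 1# φ
    φ-monic = charPoly-monic A

    φ-cancel : ∀ {d a f} → Polynomial d a f → (∀ x → f x * φ x ≈ 0#) → ∀ x → f x ≈ 0#
    φ-cancel p = *-cancel p φ-monic (trans (sym (*-identityʳ _)))

    -- Row `u` is constant in `x`, so the matrix of leading coefficients has a zero row and the
    -- degree bound falls from `n + 1` to `n`.
    C-poly : ∀ u v → ∃[ a ] Polynomial n a (λ x → C x u v)
    C-poly u v = poly-lower
      (poly-det (δ [ u ]≔ (λ _ → 0#)) (λ x → charMatrix A x [ u ]≔ δ v) entry)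
      (zero-row det-alternating {δ [ u ]≔ (λ _ → 0#)} u (≔-same δ u))
      where
      entry : ∀ i j → Polynomial 1 ((δ [ u ]≔ (λ _ → 0#)) i j) (λ x → (charMatrix A x [ u ]≔ δ v) i j)
      entry i j with i ≟ u
      ... | yes ≡.refl = poly-cong (sym (≔-same δ u j)) (λ x → sym (≔-same (charMatrix A x) u j))
        (poly-raise {0} {δ v j} λ _ → refl)
      ... | no i≢u     = poly-cong (sym (≔-other δ u i i≢u j)) (λ x → sym (≔-other (charMatrix A x) u i i≢u j))
        (charMatrix-poly A i j)

    charMatrix-sym : ∀ x i j → charMatrix A x i j ≈ charMatrix A x j i
    charMatrix-sym x i j = trans (charMatrix-δ A x i j)
      (trans (reflexive (≡.cong₂ (λ d a → x * d - a · 1#) (δ-sym i j) (A-sym i j))) (sym (charMatrix-δ A x j i)))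

    -- M Cᵀ = φ, and transposing C M = φ, so that C M Cᵀ is both φ C and φ Cᵀ.
    C-sym : ∀ x u v → C x u v ≈ C x v u
    C-sym x u v = begin
      C x u v                      ≈⟨ +-identityʳ _ ⟨
      C x u v + 0#                 ≈⟨ +-congˡ (-‿inverseˡ _) ⟨
      C x u v + (- C x v u + C x v u) ≈⟨ +-assoc _ _ _ ⟨
      C x u v - C x v u + C x v u  ≈⟨ +-congʳ (φ-cancel difference φ-multiple x) ⟩
      0# + C x v u                 ≈⟨ +-identityˡ _ ⟩
      C x v u                      ∎
      where
      difference : Polynomial n _ (λ x → C x u v - C x v u)
      difference = let _ , p = C-poly u v
                       _ , q = C-poly v u in poly-+ p (poly-neg q)

      φ-multiple : ∀ x → (C x u v - C x v u) * φ x ≈ 0#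
      φ-multiple x = begin
        (C x u v - C x v u) * φ x                      ≈⟨ solve 3 (λ a b p → (a :- b) :* p := a :* p :- b :* p) refl (C x u v) (C x v u) (φ x) ⟩
        C x u v * φ x - C x v u * φ x                  ≈⟨ +-cong (sum-δ (λ k → C x u k * φ x) v) (-‿cong (sum-δ (λ j → C x v j * φ x) u)) ⟨
        sum (λ k → C x u k * φ x * δ k v) - sum (λ j → C x v j * φ x * δ j u)
          ≈⟨ +-cong (sum-cong-≋ λ k → expandˡ k) (-‿cong (sum-cong-≋ λ j → expandʳ j)) ⟨
        sum (λ k → sum (λ j → t k j)) - sum (λ j → sum (λ k → t k j)) ≈⟨ +-congʳ (∑-comm t) ⟩
        sum (λ j → sum (λ k → t k j)) - sum (λ j → sum (λ k → t k j)) ≈⟨ -‿inverseʳ _ ⟩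
        0#                                             ∎
        where
        M : Rows (suc n) (suc n)
        M = charMatrix A x
        t : Rows (suc n) (suc n)
        t k j = C x u k * (M k j * C x v j)
        expandˡ : ∀ k → sum (λ j → t k j) ≈ C x u k * φ x * δ k v
        expandˡ k = trans (sum-*ˡ (C x u k) (λ j → M k j * C x v j))
          (trans (*-congˡ (trans (cramer M v k) (trans (*-comm _ _) (*-congˡ (reflexive (δ-sym v k)))))) (sym (*-assoc _ _ _)))
        expandʳ : ∀ j → sum (λ k → t k j) ≈ C x v j * φ x * δ j u
        expandʳ j = trans
          (sum-cong-≋ λ k → trans (*-congˡ (*-congʳ (charMatrix-sym x k j)))
            (solve 3 (λ a b c → a :* (b :* c) := c :* (b :* a)) refl (C x u k) (M j k) (C x v j)))
          (trans (sum-*ˡ (C x v j) (λ k → M j k * C x u k))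
            (trans (*-congˡ (trans (cramer M u j) (trans (*-comm _ _) (*-congˡ (reflexive (δ-sym u j)))))) (sym (*-assoc _ _ _))))

    -- The column form of `cramer`, available by symmetry; both Jacobi's identity and the bordered
    -- determinant ask for it.
    C-inverse : ∀ x v j → sum (λ k → C x k v * charMatrix A x k j) ≈ φ x * δ v j
    C-inverse x v j = begin
      sum (λ k → C x k v * charMatrix A x k j)
        ≈⟨ sum-cong-≋ (λ k → trans (*-cong (C-sym x k v) (charMatrix-sym x k j)) (*-comm _ _)) ⟩
      sum (λ k → charMatrix A x j k * C x v k) ≈⟨ cramer (charMatrix A x) v j ⟩
      δ v j * φ x                              ≈⟨ *-comm _ _ ⟩
      φ x * δ v j                              ∎

    x*C : ∀ x u v → x * C x u v ≈ sum (λ j → A v j · 1# * C x u j) + δ u v * φ x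
    x*C x u v = begin
      x * C x u v                                  ≈⟨ sum-δˡ (λ j → x * C x u j) v ⟨
      sum (λ j → δ v j * (x * C x u j))
        ≈⟨ sum-cong-≋ (λ j → trans (solve 4 (λ d x c a → d :* (x :* c) := a :* c :+ (x :* d :- a) :* c) refl (δ v j) x (C x u j) (A v j · 1#)) (+-congˡ (*-congʳ (sym (charMatrix-δ A x v j))))) ⟩
      sum (λ j → A v j · 1# * C x u j + charMatrix A x v j * C x u j)
        ≈⟨ ∑-distrib-+ (λ j → A v j · 1# * C x u j) (λ j → charMatrix A x v j * C x u j) ⟩
      sum (λ j → A v j · 1# * C x u j) + sum (λ j → charMatrix A x v j * C x u j)
        ≈⟨ +-congˡ (cramer (charMatrix A x) u v) ⟩
      sum (λ j → A v j · 1# * C x u j) + δ u v * φ x ∎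

    -- Off the diagonal `x C = A C` is a combination of cofactors, hence still of degree at most
    -- `n`. Thus an off-diagonal cofactor loses one more degree, expressed here without a
    -- predecessor of `n`.
    x*C-poly : ∀ {u v} → u ≢ v → ∃[ a ] Polynomial n a (λ x → x * C x u v)
    x*C-poly {u} {v} u≢v = _ , poly-cong refl
      (λ x → sym (trans (x*C x u v) (trans (+-congˡ (trans (*-congʳ (reflexive (δ-≢ u≢v))) (zeroˡ _))) (+-identityʳ _))))
      (poly-sum {f = λ j x → A v j · 1# * C x u j} λ j → let _ , p = C-poly u j in poly-scale (A v j · 1#) p)

    -- Walks of length k followed by C = φ (x − A)⁻¹; as x C = A C + φ, the
    -- diagonal entries grow by a factor x, up to the walk counts, when k does.
    walk : ℕ → Fin (suc n) → Carrier → Carrier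
    walk k u x = sum (λ y → C x u y * (power A k y u · 1#))

    walk-suc : ∀ k u x → x * walk k u x ≈ walk (suc k) u x + (power A k u u · 1#) * φ x
    walk-suc k u x = begin
      x * sum (λ y → C x u y * p y)                ≈⟨ sum-*ˡ x (λ y → C x u y * p y) ⟨
      sum (λ y → x * (C x u y * p y))
        ≈⟨ sum-cong-≋ (λ y → trans (sym (*-assoc _ _ _)) (trans (*-congʳ (x*C x u y)) (trans (distribʳ _ _ _) (+-cong (*-distribʳ-sum (p y) (λ j → A y j · 1# * C x u j)) (trans (*-assoc _ _ _) (*-congˡ (*-comm _ _))))))) ⟩
      sum (λ y → sum (λ j → A y j · 1# * C x u j * p y) + δ u y * (p y * φ x))
        ≈⟨ ∑-distrib-+ (λ y → sum (λ j → A y j · 1# * C x u j * p y)) (λ y → δ u y * (p y * φ x)) ⟩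
      sum (λ y → sum (λ j → A y j · 1# * C x u j * p y)) + sum (λ y → δ u y * (p y * φ x))
        ≈⟨ +-cong (∑-comm (λ y j → A y j · 1# * C x u j * p y)) (sum-δˡ (λ y → p y * φ x) u) ⟩
      sum (λ j → sum (λ y → A y j · 1# * C x u j * p y)) + p u * φ x
        ≈⟨ +-congʳ (sum-cong-≋ λ j → step j) ⟩
      walk (suc k) u x + p u * φ x                 ∎
      where
      p : Fin (suc n) → Carrier
      p y = power A k y u · 1#
      -- Symmetry of `A` turns `A y j` into `A j y`, the first step of a walk from `j`.
      step : ∀ j → sum (λ y → A y j · 1# * C x u j * p y) ≈ C x u j * (power A (suc k) j u · 1#)
      step j = begin
        sum (λ y → A y j · 1# * C x u j * p y)
          ≈⟨ sum-cong-≋ (λ y → trans (solve 3 (λ a c p → a :* c :* p := c :* (a :* p)) refl (A y j · 1#) (C x u j) (p y))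
               (*-congˡ (trans (*-congʳ (reflexive (≡.cong (_· 1#) (A-sym y j)))) (sym (×1-homo-* (A j y) (power A k y u)))))) ⟩
        sum (λ y → C x u j * ((A j y ℕ.* power A k y u) · 1#))
          ≈⟨ sum-*ˡ (C x u j) (λ y → (A j y ℕ.* power A k y u) · 1#) ⟩
        C x u j * sum (λ y → (A j y ℕ.* power A k y u) · 1#)
          ≈⟨ *-congˡ (sum-·1 (λ y → A j y ℕ.* power A k y u)) ⟨
        C x u j * (power A (suc k) j u · 1#)       ∎

    walk-zero : ∀ u x → walk 0 u x ≈ C x u u
    walk-zero u x = trans (sum-cong-≋ {y = λ y → C x u y * δ y u} λ y → *-congˡ {C x u y} (unit y)) (sum-δ (C x u) u)
      where
      unit : ∀ y → power A 0 y u · 1# ≈ δ y u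
      unit y with does (y ≟ u)
      ... | true  = +-identityʳ 1#
      ... | false = refl

    walk-poly : ∀ k u → ∃[ a ] Polynomial n a (walk k u)
    walk-poly k u = _ , poly-sum {f = λ y x → C x u y * (power A k y u · 1#)} λ y →
      let _ , p = C-poly u y in poly-cong refl (λ x → *-comm _ _) (poly-scale (power A k y u · 1#) p)

    -- Equal closed-walk counts cancel the `φ` terms of `walk-suc` in the difference for `u` and
    -- `v`. What remains is multiplied by `x` whenever `k` grows, within a fixed degree bound, so
    -- `shift-bounded` applies.
    C-diagonal : (∀ k u v → power A k u u ≡ power A k v v) → ∀ x u v → C x u u ≈ C x v v
    C-diagonal regular x u v = begin
      C x u u                                      ≈⟨ walk-zero u x ⟨
      walk 0 u x                                   ≈⟨ +-identityʳ _ ⟨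
      walk 0 u x + 0#                              ≈⟨ +-congˡ (-‿inverseˡ _) ⟨
      walk 0 u x + (- walk 0 v x + walk 0 v x)     ≈⟨ +-assoc _ _ _ ⟨
      walk 0 u x - walk 0 v x + walk 0 v x
        ≈⟨ +-congʳ (shift-bounded n (λ k x → walk k u x - walk k v x) bounded shift 0 x) ⟩
      0# + walk 0 v x                              ≈⟨ +-identityˡ _ ⟩
      walk 0 v x                                   ≈⟨ walk-zero v x ⟩
      C x v v                                      ∎
      where
      bounded : ∀ k → ∃[ a ] Polynomial n a (λ x → walk k u x - walk k v x)
      bounded k = let _ , p = walk-poly k u
                      _ , q = walk-poly k v in _ , poly-+ p (poly-neg q)
      shift : ∀ k x → walk (suc k) u x - walk (suc k) v x ≈ x * (walk k u x - walk k v x)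
      shift k x = begin
        a - b                                      ≈⟨ +-identityʳ _ ⟨
        a - b + 0#                                 ≈⟨ +-congˡ (-‿inverseʳ _) ⟨
        a - b + (p - p)
          ≈⟨ solve 3 (λ a b p → a :- b :+ (p :- p) := (a :+ p) :- (b :+ p)) refl a b p ⟩
        (a + p) - (b + p)
          ≈⟨ +-cong (walk-suc k u x) (-‿cong (trans (walk-suc k v x) (+-congˡ (*-congʳ (reflexive (≡.cong (_· 1#) (regular k v u))))))) ⟨
        x * walk k u x - x * walk k v x
          ≈⟨ solve 3 (λ x a b → x :* a :- x :* b := x :* (a :- b)) refl x (walk k u x) (walk k v x) ⟩
        x * (walk k u x - walk k v x)              ∎
        where
        a b p : Carrier
        a = walk (suc k) u x
        b = walk (suc k) v x
        p = (power A k u u · 1#) * φ x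

-- Characteristic polynomials of the three modifications of a walk-regular graph.

module GraphPolynomials {r ℓ} (R : CommutativeRing r ℓ) (torsion-free : Polynomials.TorsionFree R)
  {n} (G : Graph (suc n)) (regular : WalkRegular G) where
  open CommutativeRing R hiding (zero)
  open IntegerCoefficients R
  open Multilinear R
  open Cofactors R
  open Polynomials R
  open Cancellation torsion-free
  open CharacteristicMatrices R
  open Graph G
  open SymmetricMatrix torsion-free (adjacency G) (Pseudograph.matrix-sym (pseudo G))
  open Algebra.Properties.Ring ring
  open Algebra.Properties.Semiring.Mult semiring using (×-homo-+) renaming (_×_ to _·_)
  open Algebra.Properties.Semiring.Sum semiring
  open Relation.Binary.Reasoning.Setoid setoid

  M : Carrier → Rows (suc n) (suc n)
  M = charMatrix (adjacency G)

  ψ : Carrier → Carrier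
  ψ x = C x zero zero

  C-diag : ∀ x u → C x u u ≈ ψ x
  C-diag x u = C-diagonal regular x u zero

  φ-cofactor₂ : ∀ x {u v} (u≢v : u ≢ v) → φ x * cofactor₂ (M x) u≢v ≈ ψ x * ψ x - C x u v * C x u v
  φ-cofactor₂ x {u} {v} u≢v = trans (jacobi (M x) u≢v (C-inverse x v))
    (+-cong (*-cong (C-diag x u) (C-diag x v)) (-‿cong (*-congˡ (C-sym x v u))))

  -- Flipping a pair.

  -- The characteristic matrix contains `- a`, so deleting an edge raises an entry by one and adding
  -- an edge lowers it.
  flipSign : Bool → Carrier
  flipSign true  = 1#
  flipSign false = - 1#

  flipSign² : ∀ b → flipSign b * flipSign b ≈ 1#
  flipSign² true  = *-identityˡ 1#
  flipSign² false = trans (solve 1 (λ o → (:- o) :* (:- o) := o :* o) refl 1#) (*-identityˡ 1#)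

  flipPoly : ∀ u v → u ≢ v → Carrier → Carrier
  flipPoly u v u≢v x = det (charMatrix (adjacency (flipEdge G u v u≢v)) x)

  isPair⇒adj : ∀ u v k j → isPair u v k j ≡ true → adj k j ≡ adj u v
  isPair⇒adj u v k j eq with k ≟ u | k ≟ v | j ≟ v | j ≟ u
  ... | yes ≡.refl | _ | yes ≡.refl | _ = ≡.refl
  ... | _ | yes ≡.refl | _ | yes ≡.refl = adj-sym v u
  isPair⇒adj u v k j () | yes _ | yes _ | no _ | no _
  isPair⇒adj u v k j () | yes _ | no _ | no _ | _
  isPair⇒adj u v k j () | no _ | yes _ | _ | no _
  isPair⇒adj u v k j () | no _ | no _ | _ | _

  flip-entry : ∀ x {u v} (u≢v : u ≢ v) k j →
    charMatrix (adjacency (flipEdge G u v u≢v)) x k j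
    ≈ M x k j + flipSign (adj u v) * (if isPair u v k j then 1# else 0#)
  flip-entry x {u} {v} u≢v k j with isPair u v k j in pair
  ... | false = sym (trans (+-congˡ (zeroʳ _)) (+-identityʳ _))
  ... | true rewrite isPair⇒adj u v k j pair with adj u v
  ...   | true  = begin
    d + - 0#                     ≈⟨ +-congˡ (trans -0#≈0# (sym (-‿inverseˡ 1#))) ⟩
    d + (- 1# + 1#)              ≈⟨ +-assoc _ _ _ ⟨
    d - 1# + 1#                  ≈⟨ +-cong (+-congˡ (-‿cong (+-identityʳ 1#))) (*-identityˡ 1#) ⟨
    d - (1# + 0#) + 1# * 1#      ∎
    where
    d : Carrier
    d = if does (k ≟ j) then x else 0#
  ...   | false = begin
    d - (1# + 0#)                ≈⟨ +-cong (trans (sym (+-identityʳ d)) (+-congˡ (sym -0#≈0#))) (trans (-‿cong (+-identityʳ 1#)) (sym (*-identityʳ _))) ⟩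
    d - 0# + - 1# * 1#           ∎
    where
    d : Carrier
    d = if does (k ≟ j) then x else 0#

  isPair-first : ∀ {u v : Fin (suc n)} → u ≢ v → ∀ j → isPair u v u j ≡ does (v ≟ j)
  isPair-first {u} {v} u≢v j with u ≟ u | u ≟ v | v ≟ j | j ≟ v
  ... | no u≢u | _ | _ | _ = ⊥-elim (u≢u ≡.refl)
  ... | _ | yes u≡v | _ | _ = ⊥-elim (u≢v u≡v)
  ... | yes _ | no _ | yes _   | yes _   = ≡.refl
  ... | yes _ | no _ | no _    | no _    = ≡.refl
  ... | yes _ | no _ | yes v≡j | no j≢v  = ⊥-elim (j≢v (≡.sym v≡j))
  ... | yes _ | no _ | no v≢j  | yes j≡v = ⊥-elim (v≢j (≡.sym j≡v))

  isPair-second : ∀ {u v : Fin (suc n)} → u ≢ v → ∀ j → isPair u v v j ≡ does (u ≟ j)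
  isPair-second {u} {v} u≢v j with v ≟ v | v ≟ u | u ≟ j | j ≟ u
  ... | no v≢v | _ | _ | _ = ⊥-elim (v≢v ≡.refl)
  ... | _ | yes v≡u | _ | _ = ⊥-elim (u≢v (≡.sym v≡u))
  ... | yes _ | no _ | yes _   | yes _   = ≡.refl
  ... | yes _ | no _ | no _    | no _    = ≡.refl
  ... | yes _ | no _ | yes u≡j | no j≢u  = ⊥-elim (j≢u (≡.sym u≡j))
  ... | yes _ | no _ | no u≢j  | yes j≡u = ⊥-elim (u≢j (≡.sym j≡u))

  isPair-neither : ∀ {u v k : Fin (suc n)} → k ≢ u → k ≢ v → ∀ j → isPair u v k j ≡ false
  isPair-neither {u} {v} {k} k≢u k≢v j with k ≟ u | k ≟ v
  ... | yes k≡u | _       = ⊥-elim (k≢u k≡u)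
  ... | no _    | yes k≡v = ⊥-elim (k≢v k≡v)
  ... | no _    | no _    = ≡.refl

  -- The factor `φ` is there so that Jacobi's identity can trade the second-order cofactor for `ψ`
  -- and `C u v`; its coefficient `t * t` is one for either sign.
  φ*flipPoly : ∀ x {u v} (u≢v : u ≢ v) → let t = flipSign (adj u v) in
    φ x * flipPoly u v u≢v x ≈ φ x * φ x + (t + t) * φ x * C x u v + C x u v * C x u v - ψ x * ψ x
  φ*flipPoly x {u} {v} u≢v = begin
    φ x * flipPoly u v u≢v x
      ≈⟨ *-congˡ (trans (det-cong rows) (trans (det-flip (M x) u≢v t) (+-congˡ (*-congˡ (+-congʳ (C-sym x v u)))))) ⟩
    p * (p + t * c + t * (c - t * d))
      ≈⟨ solve 4 (λ p t c d → p :* (p :+ t :* c :+ t :* (c :- t :* d)) := p :* p :+ (t :+ t) :* p :* c :- (t :* t) :* (p :* d)) refl p t c d ⟩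
    p * p + (t + t) * p * c - (t * t) * (p * d)
      ≈⟨ +-congˡ (-‿cong (trans (*-congʳ (flipSign² (adj u v))) (trans (*-identityˡ _) (φ-cofactor₂ x u≢v)))) ⟩
    p * p + (t + t) * p * c - (ψ x * ψ x - c * c)
      ≈⟨ solve 3 (λ a q c → a :- (q :- c) := a :+ c :- q) refl (p * p + (t + t) * p * c) (ψ x * ψ x) (c * c) ⟩
    p * p + (t + t) * p * c + c * c - ψ x * ψ x ∎
    where
    p t c d : Carrier
    p = φ x
    t = flipSign (adj u v)
    c = C x u v
    d = cofactor₂ (M x) u≢v
    ind : Bool → Carrier
    ind b = if b then 1# else 0#

    F : Rows (suc n) (suc n)
    F = charMatrix (adjacency (flipEdge G u v u≢v)) x
    entry : ∀ k j {b} → isPair u v k j ≡ b → M x k j + t * ind b ≈ F k j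
    entry k j ≡.refl = sym (flip-entry x u≢v k j)
    rows : F ≋ (M x [ u ]≔ (λ j → M x u j + t * δ v j) [ v ]≔ (λ j → M x v j + t * δ u j))
    rows k j = sym (≔-≔-≋ {M = M x} {F} u v
      (λ j → entry u j (isPair-first u≢v j))
      (λ j → entry v j (isPair-second u≢v j))
      (λ k k≢u k≢v j → trans (sym (trans (+-congˡ (zeroʳ t)) (+-identityʳ _))) (entry k j (isPair-neither k≢u k≢v j)))
      k j)

  -- Amalgamating two vertices.

  amalgamPoly : (u v : Fin (suc n)) → Carrier → Carrier
  amalgamPoly u v x = det (charMatrix (Pseudograph.matrix (amalgamate G u v)) x)

  adjacent : (u v : Fin (suc n)) → Carrier
  adjacent u v = adjacency G u v · 1#

  adjacent-sym : ∀ u v → adjacent u v ≡ adjacent v u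
  adjacent-sym u v = ≡.cong (_· 1#) (Pseudograph.matrix-sym (pseudo G) u v)

  diagonal : ∀ {m} (i : Fin m) x → (if does (i ≟ i) then x else 0#) ≡ x
  diagonal i x with i ≟ i
  ... | yes _  = ≡.refl
  ... | no i≢i = ⊥-elim (i≢i ≡.refl)

  off-diagonal : ∀ {m} {i j : Fin m} → i ≢ j → ∀ x → (if does (i ≟ j) then x else 0#) ≡ 0#
  off-diagonal {i = i} {j} i≢j x with i ≟ j
  ... | yes i≡j = ⊥-elim (i≢j i≡j)
  ... | no _    = ≡.refl

  M-diag : ∀ x u → M x u u ≈ x
  M-diag x u rewrite adj-irrefl u =
    trans (+-cong (reflexive (diagonal u x)) -0#≈0#) (+-identityʳ x)

  M-off : ∀ x {u v} → u ≢ v → M x u v ≈ - adjacent u v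
  M-off x u≢v = trans (+-congʳ (reflexive (off-diagonal u≢v x))) (+-identityˡ _)

  punchIn-≟ : ∀ {m} (v : Fin (suc m)) i j → does (punchIn v i ≟ punchIn v j) ≡ does (i ≟ j)
  punchIn-≟ v i j with punchIn v i ≟ punchIn v j | i ≟ j
  ... | yes _  | yes _      = ≡.refl
  ... | no _   | no _       = ≡.refl
  ... | yes eq | no i≢j     = ⊥-elim (i≢j (punchIn-injective v i j eq))
  ... | no neq | yes ≡.refl = ⊥-elim (neq ≡.refl)

  -- Adding row and column v to row and column u puts 2 (x − a) at (u , u)
  -- instead of the x − a of the amalgamated graph, hence the correction.
  merged : ∀ u v → Carrier → Rows (suc n) (suc n)
  merged u v x = M x [ u ]≔ (λ j → M x u j + M x v j - (x - adjacent u v) * δ u j)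
                     [ v ]≔ (λ j → δ v j - δ u j)

  amalgam-entry : ∀ x {u v} → u ≢ v → ∀ i j →
    charMatrix (Pseudograph.matrix (amalgamate G u v)) x i j
    ≈ merged u v x (punchIn v i) (punchIn v j) + merged u v x (punchIn v i) v * δ u (punchIn v j)
  -- The diagonal test is moved from `i` and `j` to their images, so that both sides speak about
  -- vertices of `G` other than `v`.
  amalgam-entry x {u} {v} u≢v i j rewrite ≡.sym (punchIn-≟ v i j) =
    entry (punchIn v i) (punchIn v j) (punchInᵢ≢i v i) (punchInᵢ≢i v j)
    where
    y : Carrier
    y = x - adjacent u v

    merged-u : ∀ j → merged u v x u j ≈ M x u j + M x v j - y * δ u j
    merged-u j = trans (≔-other (M x [ u ]≔ _) v u u≢v j) (≔-same (M x) u j)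

    merged-off : ∀ {k} → k ≢ u → k ≢ v → ∀ j → merged u v x k j ≈ M x k j
    merged-off k≢u k≢v j = trans (≔-other (M x [ u ]≔ _) v _ k≢v j) (≔-other (M x) u _ k≢u j)

    entry : ∀ k l → k ≢ v → l ≢ v →
      (if does (k ≟ l) then x else 0#) -
        (if does (k ≟ u)
         then (if does (l ≟ u) then adjacency G u v else adjacency G u l ℕ.+ adjacency G v l)
         else (if does (l ≟ u) then adjacency G u k ℕ.+ adjacency G v k else adjacency G k l)) · 1#
      ≈ merged u v x k l + merged u v x k v * δ u l
    entry k l k≢v l≢v with k ≟ u | l ≟ u
    ... | yes ≡.refl | yes ≡.refl = begin
      (if does (u ≟ u) then x else 0#) - adjacent u v ≈⟨ +-congʳ (reflexive (diagonal u x)) ⟩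
      y
        ≈⟨ solve 2 (λ x a → x :- a := (x :+ (:- a) :- (x :- a)) :+ ((:- a) :+ x)) refl x (adjacent u v) ⟩
      (x + - adjacent u v - y) + (- adjacent u v + x)
        ≈⟨ +-cong (+-cong (+-cong (M-diag x u) (trans (M-off x (u≢v ∘ ≡.sym)) (-‿cong (reflexive (adjacent-sym v u))))) (-‿cong (trans (*-congˡ (reflexive (δ-refl u))) (*-identityʳ y))))
                  (trans (*-cong (trans (+-cong (+-cong (M-off x u≢v) (M-diag x v)) (trans (-‿cong (trans (*-congˡ (reflexive (δ-≢ u≢v))) (zeroʳ y))) -0#≈0#)) (+-identityʳ _)) (reflexive (δ-refl u))) (*-identityʳ _)) ⟨
      (M x u u + M x v u - y * δ u u) + (M x u v + M x v v - y * δ u v) * δ u u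
        ≈⟨ +-cong (merged-u u) (*-congʳ (merged-u v)) ⟨
      merged u v x u u + merged u v x u v * δ u u ∎
    ... | yes ≡.refl | no l≢u = begin
      (if does (u ≟ l) then x else 0#) - (adjacency G u l ℕ.+ adjacency G v l) · 1#
        ≈⟨ +-cong (reflexive (off-diagonal u≢l x)) (-‿cong (×-homo-+ 1# (adjacency G u l) (adjacency G v l))) ⟩
      0# - (adjacent u l + adjacent v l)
        ≈⟨ solve 3 (λ z a b → z :- (a :+ b) := (:- a) :+ (:- b) :- (:- z)) refl 0# (adjacent u l) (adjacent v l) ⟩
      - adjacent u l + - adjacent v l - - 0#
        ≈⟨ +-cong (+-cong (M-off x u≢l) (M-off x (l≢v ∘ ≡.sym))) (-‿cong (trans (trans (*-congˡ (reflexive (δ-≢ u≢l))) (zeroʳ y)) (sym -0#≈0#))) ⟨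
      M x u l + M x v l - y * δ u l                   ≈⟨ +-identityʳ _ ⟨
      M x u l + M x v l - y * δ u l + 0#
        ≈⟨ +-cong (merged-u l) (trans (*-congˡ (reflexive (δ-≢ u≢l))) (zeroʳ _)) ⟨
      merged u v x u l + merged u v x u v * δ u l     ∎
      where
      u≢l : u ≢ l
      u≢l = l≢u ∘ ≡.sym
    ... | no k≢u | yes ≡.refl = begin
      (if does (k ≟ u) then x else 0#) - (adjacency G u k ℕ.+ adjacency G v k) · 1#
        ≈⟨ +-cong (reflexive (off-diagonal k≢u x)) (-‿cong (×-homo-+ 1# (adjacency G u k) (adjacency G v k))) ⟩
      0# - (adjacent u k + adjacent v k)              ≈⟨ +-identityˡ _ ⟩
      - (adjacent u k + adjacent v k)                 ≈⟨ solve 2 (λ a b → :- (a :+ b) := (:- a) :+ (:- b)) refl _ _ ⟩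
      - adjacent u k + - adjacent v k
        ≈⟨ +-cong (trans (M-off x k≢u) (-‿cong (reflexive (adjacent-sym k u)))) (trans (*-cong (trans (M-off x k≢v) (-‿cong (reflexive (adjacent-sym k v)))) (reflexive (δ-refl u))) (*-identityʳ _)) ⟨
      M x k u + M x k v * δ u u                       ≈⟨ +-cong (merged-off k≢u k≢v u) (*-congʳ (merged-off k≢u k≢v v)) ⟨
      merged u v x k u + merged u v x k v * δ u u     ∎
    ... | no k≢u | no l≢u = begin
      M x k l                                         ≈⟨ merged-off k≢u k≢v l ⟨
      merged u v x k l                                ≈⟨ +-identityʳ _ ⟨
      merged u v x k l + 0#                           ≈⟨ +-congˡ (trans (*-congˡ (reflexive (δ-≢ (l≢u ∘ ≡.sym)))) (zeroʳ _)) ⟨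
      merged u v x k l + merged u v x k v * δ u l     ∎

  -- Row `v` of `merged` is chosen as `δ v - δ u` so that adding column `v` to column `u` makes it
  -- the unit row `δ v`. Removing row and column `v` then leaves the matrix of the amalgamated
  -- graph.
  amalgamPoly≈merged : ∀ x {u v} → u ≢ v → amalgamPoly u v x ≈ det (merged u v x)
  amalgamPoly≈merged x {u} {v} u≢v = begin
    amalgamPoly u v x                                 ≈⟨ det-cong (amalgam-entry x u≢v) ⟩
    det (λ i j → H (punchIn v i) (punchIn v j))       ≈⟨ det-unit-row {M = H} v unit ⟨
    det H                                             ≈⟨ det-add-column (merged u v x) u≢v ⟩
    det (merged u v x)                                ∎
    where
    H : Rows (suc n) (suc n)
    H i j = merged u v x i j + merged u v x i v * δ u j
    row-v : ∀ j → merged u v x v j ≈ δ v j - δ u j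
    row-v = ≔-same (M x [ u ]≔ _) v
    unit : ∀ j → H v j ≈ δ v j
    unit j = begin
      merged u v x v j + merged u v x v v * δ u j
        ≈⟨ +-cong (row-v j) (*-congʳ (trans (row-v v) (trans (+-cong (reflexive (δ-refl v)) (trans (-‿cong (reflexive (δ-≢ u≢v))) -0#≈0#)) (+-identityʳ 1#)))) ⟩
      δ v j - δ u j + 1# * δ u j                      ≈⟨ trans (+-congˡ (*-identityˡ _)) (trans (+-assoc _ _ _) (trans (+-congˡ (-‿inverseˡ _)) (+-identityʳ _))) ⟩
      δ v j                                           ∎

  φ*amalgamPoly : ∀ x {u v} → u ≢ v →
    φ x * amalgamPoly u v x ≈ φ x * ((ψ x + ψ x) - (C x u v + C x u v))
                              - (x - adjacent u v) * (ψ x * ψ x - C x u v * C x u v)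
  φ*amalgamPoly x {u} {v} u≢v = begin
    φ x * amalgamPoly u v x
      ≈⟨ *-congˡ (trans (amalgamPoly≈merged x u≢v) (trans (det-merge (M x) u≢v y)
           (+-congʳ (+-cong (+-congʳ (+-cong (C-diag x u) (C-diag x v))) (-‿cong (C-sym x v u)))))) ⟩
    φ x * (ψ x + ψ x - c - c - y * d)
      ≈⟨ solve 5 (λ p q c y d → p :* (q :+ q :- c :- c :- y :* d) := p :* ((q :+ q) :- (c :+ c)) :- y :* (p :* d)) refl (φ x) (ψ x) c y d ⟩
    φ x * ((ψ x + ψ x) - (c + c)) - y * (φ x * d)     ≈⟨ +-congˡ (-‿cong (*-congˡ (φ-cofactor₂ x u≢v))) ⟩
    φ x * ((ψ x + ψ x) - (c + c)) - y * (ψ x * ψ x - c * c) ∎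
    where
    c y d : Carrier
    c = C x u v
    y = x - adjacent u v
    d = cofactor₂ (M x) u≢v

  -- Adding a common neighbour.

  neighbourPoly : (u v : Fin (suc n)) → Carrier → Carrier
  neighbourPoly u v x = det (charMatrix (adjacency (addCommonNeighbour G u v)) x)

  -- The new vertex borders `M` by `b`, the indicator of `u` and `v`. The sum `y` of the columns `u`
  -- and `v` of `C` satisfies `yᵀ M = φ bᵀ`, so it eliminates the border, and `yᵀ b` sums the four
  -- entries of `C` at `u` and `v`.
  φ*neighbourPoly : ∀ x {u v} → u ≢ v →
    φ x * neighbourPoly u v x ≈ (φ x * x - ((ψ x + ψ x) + (C x u v + C x u v))) * φ x
  φ*neighbourPoly x {u} {v} u≢v = trans
    (det-bordered S b y (φ x) (λ j → top j) left eliminate)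
    (*-congʳ (+-cong (*-congˡ (trans (+-congˡ -0#≈0#) (+-identityʳ x))) (-‿cong total)))
    where
    S : Rows (suc (suc n)) (suc (suc n))
    S = charMatrix (adjacency (addCommonNeighbour G u v)) x
    b y : Fin (suc n) → Carrier
    b j = δ u j + δ v j
    y i = C x i u + C x i v

    isEnd : ∀ j → (if does (j ≟ u) ∨ does (j ≟ v) then 1 else 0) · 1# ≈ b j
    isEnd j rewrite δ-sym u j | δ-sym v j with j ≟ u | j ≟ v
    ... | yes ≡.refl | yes ≡.refl = ⊥-elim (u≢v ≡.refl)
    ... | yes _ | no _  = refl
    ... | no _  | yes _ = +-comm 1# 0#
    ... | no _  | no _  = sym (+-identityʳ 0#)

    top : ∀ j → S zero (suc j) ≈ - b j
    top j = trans (+-identityˡ _) (-‿cong (isEnd j))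
    left : ∀ i → S (suc i) zero ≈ - b i
    left i = trans (+-identityˡ _) (-‿cong (isEnd i))

    eliminate : ∀ j → sum (λ i → y i * M x i j) ≈ φ x * b j
    eliminate j = begin
      sum (λ i → (C x i u + C x i v) * M x i j)      ≈⟨ sum-cong-≋ (λ i → distribʳ (M x i j) (C x i u) (C x i v)) ⟩
      sum (λ i → C x i u * M x i j + C x i v * M x i j) ≈⟨ ∑-distrib-+ (λ i → C x i u * M x i j) (λ i → C x i v * M x i j) ⟩
      sum (λ i → C x i u * M x i j) + sum (λ i → C x i v * M x i j) ≈⟨ +-cong (C-inverse x u j) (C-inverse x v j) ⟩
      φ x * δ u j + φ x * δ v j                      ≈⟨ distribˡ _ _ _ ⟨
      φ x * b j                                      ∎

    total : sum (λ i → y i * b i) ≈ (ψ x + ψ x) + (C x u v + C x u v)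
    total = begin
      sum (λ i → y i * (δ u i + δ v i))              ≈⟨ sum-cong-≋ {y = λ i → δ u i * y i + δ v i * y i} (λ i → trans (distribˡ (y i) (δ u i) (δ v i)) (+-cong (*-comm _ _) (*-comm _ _))) ⟩
      sum (λ i → δ u i * y i + δ v i * y i)          ≈⟨ ∑-distrib-+ (λ i → δ u i * y i) (λ i → δ v i * y i) ⟩
      sum (λ i → δ u i * y i) + sum (λ i → δ v i * y i) ≈⟨ +-cong (sum-δˡ y u) (sum-δˡ y v) ⟩
      (C x u u + C x u v) + (C x v u + C x v v)      ≈⟨ +-cong (+-congʳ (C-diag x u)) (+-cong (C-sym x v u) (C-diag x v)) ⟩
      (ψ x + C x u v) + (C x u v + ψ x)              ≈⟨ solve 2 (λ q c → (q :+ c) :+ (c :+ q) := (q :+ q) :+ (c :+ c)) refl (ψ x) (C x u v) ⟩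
      (ψ x + ψ x) + (C x u v + C x u v)              ∎

  -- Cancelling `2` and `φ`.

  double-cancel : ∀ {y} → y + y ≈ 0# → y ≈ 0#
  double-cancel {y} 2y≈0 = torsion-free 1 (begin
    (1# + (1# + 0#)) * y   ≈⟨ *-congʳ (+-congˡ (+-identityʳ 1#)) ⟩
    (1# + 1#) * y          ≈⟨ distribʳ y 1# 1# ⟩
    1# * y + 1# * y        ≈⟨ +-cong (*-identityˡ y) (*-identityˡ y) ⟩
    y + y                  ≈⟨ 2y≈0 ⟩
    0#                     ∎)

  minus-two-cancel : ∀ {b y} → b ≈ - (1# + 1#) → y * b ≈ 0# → y ≈ 0#
  minus-two-cancel {b} {y} b≈-2 yb≈0 = double-cancel (begin
    y + y                        ≈⟨ +-cong (*-identityʳ y) (*-identityʳ y) ⟨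
    y * 1# + y * 1#              ≈⟨ solve 2 (λ y o → y :* o :+ y :* o := :- (y :* (:- (o :+ o)))) refl y 1# ⟩
    - (y * - (1# + 1#))          ≈⟨ -‿cong (*-congˡ b≈-2) ⟨
    - (y * b)                    ≈⟨ trans (-‿cong yb≈0) -0#≈0# ⟩
    0#                           ∎)

  difference≈0 : ∀ {a b} → a ≈ b → a - b ≈ 0#
  difference≈0 {a} {b} a≈b = trans (+-congʳ a≈b) (-‿inverseʳ b)

  -- The hypothesis says nothing at zeros of `φ`; the conclusion holds there too because `φ` is
  -- cancelled as a monic polynomial.
  charPoly-cancel : ∀ {m} (A B : Matrix ℕ m) →
    (∀ x → φ x * det (charMatrix A x) ≈ φ x * det (charMatrix B x)) →
    ∀ x → det (charMatrix A x) ≈ det (charMatrix B x)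
  charPoly-cancel A B eq x = x∙y⁻¹≈ε⇒x≈y _ _ (φ-cancel
    (poly-+ (charPoly-monic A) (poly-neg (charPoly-monic B)))
    (λ x → trans (solve 3 (λ a b p → (a :- b) :* p := p :* a :- p :* b) refl (det (charMatrix A x)) (det (charMatrix B x)) (φ x))
                 (difference≈0 (eq x))) x)

  -- Comparing two pairs of vertices through their cofactors.

  module Pairs {u v w z : Fin (suc n)} (u≢v : u ≢ v) (w≢z : w ≢ z) (same-adj : adj u v ≡ adj w z) where
    private
      c c′ : Carrier → Carrier
      c x = C x u v
      c′ x = C x w z
      t : Carrier
      t = flipSign (adj u v)

      2φ : Polynomial (suc n) (1# + 1#) (λ x → φ x + φ x)
      2φ = poly-+ φ-monic φ-monic

      c+c′ : ∃[ a ] Polynomial n a (λ x → c x + c′ x)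
      c+c′ = let _ , p = C-poly u v
                 _ , q = C-poly w z in _ , poly-+ p q

      -- The common end of the three arguments: each factors the difference of its two polynomials,
      -- times `φ`, as `c - c′` times some `r`.
      cofactors-equal : ∀ {d b} {r : Carrier → Carrier} → Polynomial d b r → (∀ {y} → y * b ≈ 0# → y ≈ 0#) →
                        (∀ x → (c x - c′ x) * r x ≈ 0#) → ∀ x → c x ≈ c′ x
      cofactors-equal r-poly cancel product≈0 x = x∙y⁻¹≈ε⇒x≈y _ _
        (let _ , p = C-poly u v
             _ , q = C-poly w z in *-cancel (poly-+ p (poly-neg q)) r-poly cancel product≈0 x)

    -- The terms quadratic in the cofactors factor as a difference of squares, which gives
    -- `r = c + c′ + 2 t φ`; here `φ` dominates because cofactors have lower degree.
    flip⇒cofactor : (∀ x → flipPoly u v u≢v x ≈ flipPoly w z w≢z x) → ∀ x → C x u v ≈ C x w z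
    flip⇒cofactor eq = cofactors-equal {r = λ x → (c x + c′ x) + (t + t) * φ x}
      (let _ , p = c+c′ in poly-+ (poly-raise p) (poly-scale (t + t) φ-monic))
      -- The leading coefficient is `2 t`: the factor `2` goes by torsion-freeness, then `t` because
      -- `t * t` is one.
      (λ {y} yb≈0 → begin
        y               ≈⟨ *-identityˡ y ⟨
        1# * y          ≈⟨ *-congʳ (flipSign² (adj u v)) ⟨
        t * t * y       ≈⟨ *-assoc t t y ⟩
        t * (t * y)     ≈⟨ *-congˡ (double-cancel (begin
          t * y + t * y                ≈⟨ solve 2 (λ t y → t :* y :+ t :* y := y :* (t :+ t)) refl t y ⟩
          y * (t + t)                  ≈⟨ *-congˡ (trans (+-identityˡ _) (*-identityʳ _)) ⟨
          y * (0# + (t + t) * 1#)      ≈⟨ yb≈0 ⟩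
          0#                           ∎)) ⟩
        t * 0#          ≈⟨ zeroʳ t ⟩
        0#              ∎)
      λ x → trans
        (solve 5 (λ c d t p q → (c :- d) :* ((c :+ d) :+ (t :+ t) :* p)
                  := (p :* p :+ (t :+ t) :* p :* c :+ c :* c :- q :* q) :- (p :* p :+ (t :+ t) :* p :* d :+ d :* d :- q :* q))
          refl (c x) (c′ x) t (φ x) (ψ x))
        (difference≈0 (trans (sym (φ*flipPoly x u≢v)) (trans (*-congˡ (eq x))
          (trans (φ*flipPoly x w≢z) (reflexive (≡.cong (λ b → φ x * φ x + (flipSign b + flipSign b) * φ x * c′ x + c′ x * c′ x - ψ x * ψ x) (≡.sym same-adj)))))))

    cofactor⇒flip : (∀ x → C x u v ≈ C x w z) → ∀ x → flipPoly u v u≢v x ≈ flipPoly w z w≢z x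
    cofactor⇒flip eq = charPoly-cancel
      (adjacency (flipEdge G u v u≢v)) (adjacency (flipEdge G w z w≢z)) λ x →
      trans (φ*flipPoly x u≢v) (trans
        (+-congʳ (+-cong (+-congˡ (*-cong (*-congʳ (reflexive (≡.cong (λ b → flipSign b + flipSign b) same-adj))) (eq x))) (*-cong (eq x) (eq x))))
        (sym (φ*flipPoly x w≢z)))

    same-adjacent : adjacent u v ≡ adjacent w z
    same-adjacent = ≡.cong (λ b → (if b then 1 else 0) · 1#) same-adj

    -- With `a` the common adjacency, `r = - 2 φ + (x - a) (c + c′)`. Judged by `C-poly` alone, the
    -- second summand could have degree `n + 1` and disturb the leading coefficient; `x*C-poly`
    -- excludes this.
    amalgam⇒cofactor : (∀ x → amalgamPoly u v x ≈ amalgamPoly w z x) → ∀ x → C x u v ≈ C x w z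
    amalgam⇒cofactor eq = cofactors-equal
      {r = λ x → - (φ x + φ x) + (x * c x + x * c′ x - adjacent u v * (c x + c′ x))}
      (let _ , p = x*C-poly u≢v
           _ , q = x*C-poly w≢z
           _ , s = c+c′
       in poly-+ (poly-neg 2φ) (poly-raise (poly-+ (poly-+ p q) (poly-neg (poly-scale (adjacent u v) s)))))
      (minus-two-cancel (+-identityʳ _))
      λ x → trans
        (solve 6 (λ c d x a p q → (c :- d) :* ((:- (p :+ p)) :+ (x :* c :+ x :* d :- a :* (c :+ d)))
                  := (p :* ((q :+ q) :- (c :+ c)) :- (x :- a) :* (q :* q :- c :* c))
                     :- (p :* ((q :+ q) :- (d :+ d)) :- (x :- a) :* (q :* q :- d :* d)))
          refl (c x) (c′ x) x (adjacent u v) (φ x) (ψ x))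
        (difference≈0 (trans (sym (φ*amalgamPoly x u≢v)) (trans (*-congˡ (eq x))
          (trans (φ*amalgamPoly x w≢z) (+-congˡ (-‿cong (*-congʳ (+-congˡ (-‿cong (reflexive (≡.sym same-adjacent))))))))))) 

    cofactor⇒amalgam : (∀ x → C x u v ≈ C x w z) → ∀ x → amalgamPoly u v x ≈ amalgamPoly w z x
    cofactor⇒amalgam eq = charPoly-cancel
      (Pseudograph.matrix (amalgamate G u v)) (Pseudograph.matrix (amalgamate G w z)) λ x →
      trans (φ*amalgamPoly x u≢v) (trans
        (+-cong (*-congˡ (+-congˡ (-‿cong (+-cong (eq x) (eq x)))))
                (-‿cong (*-cong (+-congˡ (-‿cong (reflexive same-adjacent))) (+-congˡ (-‿cong (*-cong (eq x) (eq x)))))))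
        (sym (φ*amalgamPoly x w≢z)))

    -- The cofactor enters linearly, so the remaining factor is just `- 2 φ`.
    neighbour⇒cofactor : (∀ x → neighbourPoly u v x ≈ neighbourPoly w z x) → ∀ x → C x u v ≈ C x w z
    neighbour⇒cofactor eq = cofactors-equal {r = λ x → - (φ x + φ x)} (poly-neg 2φ) (minus-two-cancel refl)
      λ x → trans
        (solve 5 (λ c d x p q → (c :- d) :* (:- (p :+ p))
                  := (p :* x :- ((q :+ q) :+ (c :+ c))) :* p :- (p :* x :- ((q :+ q) :+ (d :+ d))) :* p)
          refl (c x) (c′ x) x (φ x) (ψ x))
        (difference≈0 (trans (sym (φ*neighbourPoly x u≢v)) (trans (*-congˡ (eq x)) (φ*neighbourPoly x w≢z))))

    cofactor⇒neighbour : (∀ x → C x u v ≈ C x w z) → ∀ x → neighbourPoly u v x ≈ neighbourPoly w z x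
    cofactor⇒neighbour eq = charPoly-cancel
      (adjacency (addCommonNeighbour G u v)) (adjacency (addCommonNeighbour G w z)) λ x →
      trans (φ*neighbourPoly x u≢v) (trans
        (*-congʳ (+-congˡ (-‿cong (+-congˡ (+-cong (eq x) (eq x))))))
        (sym (φ*neighbourPoly x w≢z)))

-- From characteristic polynomials to spectra.

T⇔⇒≡ : ∀ {a b} → T a ⇔ T b → a ≡ b
T⇔⇒≡ {true}  {true}  _ = ≡.refl
T⇔⇒≡ {false} {false} _ = ≡.refl
T⇔⇒≡ {true}  {false} e = ⊥-elim (Equivalence.to e _)
T⇔⇒≡ {false} {true}  e = ⊥-elim (Equivalence.from e _)

module Spectra {c ℓ₁ ℓ₂} (K : HeytingField c ℓ₁ ℓ₂)
  (char0 : CharacteristicZero K) (closed : AlgebraicallyClosed K) where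
  open HeytingField K using (#⇒invertible)
  open Spectrum K using (commutativeRing; charPoly)
  open CommutativeRing commutativeRing hiding (zero)
  open Algebra.Properties.Ring ring using (-0#≈0#)
  open Algebra.Definitions.RawSemiring (Semiring.rawSemiring semiring) using () renaming (_×_ to _·_)
  open Polynomials commutativeRing using (TorsionFree; poly-splits)
  open CharacteristicMatrices commutativeRing using (charPoly-monic)
  open Relation.Binary.Reasoning.Setoid setoid

  torsion-free : TorsionFree
  torsion-free n {y} ny≈0 with #⇒invertible (char0 n)
  ... | inv , inv-left , _ = begin
    y                              ≈⟨ *-identityˡ y ⟨
    1# * y                         ≈⟨ *-congʳ inv-left ⟨
    -- Apartness from `0#` gives an inverse of the difference `k - 0#`, not of `k` itself.
    inv * (k - 0#) * y             ≈⟨ *-assoc _ _ _ ⟩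
    inv * ((k - 0#) * y)           ≈⟨ *-congˡ (*-congʳ (trans (+-congˡ -0#≈0#) (+-identityʳ k))) ⟩
    inv * (k * y)                  ≈⟨ trans (*-congˡ ny≈0) (zeroʳ inv) ⟩
    0#                             ∎
    where
    k : Carrier
    k = suc n · 1#

  spectrum⇒charPoly : ∀ {m} (G H : Pseudograph m) → SameSpectrum K G H →
                      ∀ x → charPoly (Pseudograph.matrix G) x ≈ charPoly (Pseudograph.matrix H) x
  spectrum⇒charPoly G H (_ , spG , spH) x = trans (spG x) (sym (spH x))

  -- Algebraic closedness splits one characteristic polynomial, and the same list of roots then
  -- serves for the other.
  charPoly⇒spectrum : ∀ {m} (G H : Pseudograph m) →
                      (∀ x → charPoly (Pseudograph.matrix G) x ≈ charPoly (Pseudograph.matrix H) x) →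
                      SameSpectrum K G H
  charPoly⇒spectrum G H eq =
    let λs , split = poly-splits closed (charPoly-monic (Pseudograph.matrix G))
    in λs , split , λ x → trans (sym (eq x)) (split x)

proposition4p3 : ∀ {c ℓ₁ ℓ₂} (K : HeytingField c ℓ₁ ℓ₂)
    → CharacteristicZero K → AlgebraicallyClosed K
    → (n : ℕ) (G : Graph (suc n)) → Connected G → WalkRegular G
    → (u v w z : Fin (suc n)) (u≢v : u ≢ v) (w≢z : w ≢ z)
    → (Graph._∼_ G u v ⇔ Graph._∼_ G w z)
    → (SameSpectrum K (pseudo (flipEdge G u v u≢v)) (pseudo (flipEdge G w z w≢z))
    ⇔ SameSpectrum K (amalgamate G u v) (amalgamate G w z))
    × (SameSpectrum K (amalgamate G u v) (amalgamate G w z)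
    ⇔ SameSpectrum K (pseudo (addCommonNeighbour G u v)) (pseudo (addCommonNeighbour G w z)))
proposition4p3 K char0 closed n G _ regular u v w z u≢v w≢z same-adj =
  mk⇔ (charPoly⇒spectrum (A u v) (A w z) ∘ cofactor⇒amalgam ∘ flip⇒cofactor ∘ spectrum⇒charPoly (F u v u≢v) (F w z w≢z))
      (charPoly⇒spectrum (F u v u≢v) (F w z w≢z) ∘ cofactor⇒flip ∘ amalgam⇒cofactor ∘ spectrum⇒charPoly (A u v) (A w z)) ,
  mk⇔ (charPoly⇒spectrum (N u v) (N w z) ∘ cofactor⇒neighbour ∘ amalgam⇒cofactor ∘ spectrum⇒charPoly (A u v) (A w z))
      (charPoly⇒spectrum (A u v) (A w z) ∘ cofactor⇒amalgam ∘ neighbour⇒cofactor ∘ spectrum⇒charPoly (N u v) (N w z))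
  where
  open Spectra K char0 closed
  open GraphPolynomials (Spectrum.commutativeRing K) torsion-free G regular
  open Pairs u≢v w≢z (T⇔⇒≡ same-adj)

  F : ∀ u v → u ≢ v → Pseudograph (suc n)
  F u v u≢v = pseudo (flipEdge G u v u≢v)
  A : ∀ u v → Pseudograph n
  A = amalgamate G
  N : ∀ u v → Pseudograph (suc (suc n))
  N u v = pseudo (addCommonNeighbour G u v)
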